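{- With the notation of the context, let $f(g)$ be the number of $k$-tuples of nonnegative integers $[g_1,\dots,g_k]$ with $\sum_i g_i=g$ and $g_i\le\alpha_i g$ for all $i$. Then, as formal power series, \[ F(x)=\sum_{g=0}^\infty f(g)x^g=\frac{\sum_{\mathbf{a}\in\mathcal{A}}x^{b(\mathbf{a})}}{\prod_{i=1}^k\left(1-x^{N/n_i}\right)}. \]
   Context: Let $k\ge 2$ and let $\alpha_1,\dots,\alpha_k$ be nonnegative rational numbers such that the sum of any $k-1$ of them is at most $1$ and $\sum_i\alpha_i>1$. Write $\alpha_i=m_i/n_i$ in lowest terms with $n_i\ge 1$. Set $N=\prod_{i=1}^k n_i$, $A=N(\sum_{i=1}^k\alpha_i-1)$ (a positive integer), and $\hat\alpha_i=1-\sum_{j\ne i}\alpha_j$. Let $\mathcal{A}$ be the set of integer $k$-tuples $\mathbf{a}=(a_1,\dots,a_k)$ with $0\le a_i<A$ for all $i$ such that for every $1\le j\le k$ the integer $N\hat\alpha_j\frac{a_j}{n_j}+N\alpha_j\sum_{i\ne j}\frac{a_i}{n_i}$ is divisible by $A$. For $\mathbf{a}\in\mathcal{A}$ put $b(\mathbf{a})=\frac{N}{A}\sum_{i=1}^k\frac{a_i}{n_i}$ (a nonnegative integer). -}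

module Defs where

open import Algebra.Properties.CommutativeMonoid.Sum as BigOp using ()
import Algebra.Properties.Semiring.Sum as SemiringSum
import Algebra.Bundles
open import Data.Bool.Base using (if_then_else_)
open import Data.Fin.Base using (Fin; zero; suc; toℕ)
import Data.Fin.Properties as Fin
open import Data.Integer.Base as ℤ using (ℤ; +_; 0ℤ; 1ℤ)
import Data.Integer.Properties as ℤ
open import Data.List.Base as List using (List; []; _∷_; upTo; filter; length; cartesianProductWith)
open import Data.List.Membership.Propositional using (_∈_)
import Data.List.Membership.Propositional.Properties as ∈
open import Data.List.Relation.Unary.Any using (here)
import Data.List.Relation.Unary.All as All
open import Data.List.Relation.Unary.Unique.Propositional using (Unique)
import Data.List.Relation.Unary.Unique.Propositional.Properties as Unique
import Data.List.Relation.Unary.AllPairs as AllPairs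
open import Data.Nat.Base as ℕ using (ℕ; zero; suc)
import Data.Nat.DivMod as ℕ
import Data.Nat.Divisibility as ℕ
import Data.Nat.Properties as ℕ
open import Data.Product.Base using (∃-syntax; _×_; _,_)
open import Data.Rational.Base
  using (ℚ; 1ℚ; 0ℚ; _/_; ↥_; ↧ₙ_; _+_; _-_; -_; _*_; _÷_; 1/_; _≤_; _<_; NonZero; Positive; positive; nonNegative; mkℚ; toℚᵘ)
import Data.Rational.Properties as ℚ
open import Data.Rational.Solver using (module +-*-Solver)
import Data.Nat.Coprimality as Coprime
import Data.Rational.Unnormalised.Base as ℚᵘ
import Data.Rational.Unnormalised.Properties as ℚᵘ
open import Data.Vec.Base as Vec using (Vec; []; _∷_; lookup)
open import Data.Vec.Functional as Vector using (Vector)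
import Data.Vec.Properties as Vec
open import Relation.Binary.PropositionalEquality
  using (_≡_; refl; sym; trans; cong; cong₂; subst; module ≡-Reasoning)
open import Relation.Nullary using (Dec; does)
open import Relation.Nullary.Decidable using (_×-dec_)

private module ∑ℚ = SemiringSum (Algebra.Bundles.CommutativeRing.semiring ℚ.+-*-commutativeRing)
open ∑ℚ public using () renaming (sum to ∑)
open BigOp ℤ.+-0-commutativeMonoid public using () renaming (sum to ∑ℤ)
open BigOp ℕ.*-1-commutativeMonoid public using () renaming (sum to ∏ℕ)

private variable k : ℕ

-- p n is the coefficient of xⁿ.
PowerSeries : Set
PowerSeries = ℕ → ℤ

infix  4 _≈_ _≈_⊘_
infixl 6 _⊕_
infixl 7 _⊛_

_≈_ : PowerSeries → PowerSeries → Set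
p ≈ q = ∀ n → p n ≡ q n

_⊕_ : PowerSeries → PowerSeries → PowerSeries
(p ⊕ q) n = p n ℤ.+ q n

_⊛_ : PowerSeries → PowerSeries → PowerSeries
(p ⊛ q) n = ∑ℤ {suc n} λ i → p (toℕ i) ℤ.* q (n ℕ.∸ toℕ i)

0ₚ : PowerSeries
0ₚ _ = 0ℤ

x^_ : ℕ → PowerSeries
(x^ m) n = if does (n ℕ.≟ m) then 1ℤ else 0ℤ

1ₚ : PowerSeries
1ₚ = x^ 0

1-x^_ : ℕ → PowerSeries
(1-x^ m) n = 1ₚ n ℤ.- (x^ m) n

∏ₚ : Vector PowerSeries k → PowerSeries
∏ₚ = Vector.foldr _⊛_ 1ₚ

∑ₚ : List PowerSeries → PowerSeries
∑ₚ = List.foldr _⊕_ 0ₚ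

-- f ≈ p ⊘ q : f is the quotient p / q in ℤ⟦x⟧, i.e. q is a unit and f·q = p.
_≈_⊘_ : PowerSeries → PowerSeries → PowerSeries → Set
f ≈ p ⊘ q = (∃[ r ] q ⊛ r ≈ 1ₚ) × f ⊛ q ≈ p

fromℕ : ℕ → ℚ
fromℕ n = + n / 1

IsInteger : ℚ → Set
IsInteger q = ↧ₙ q ≡ 1

-- Only meaningful on nonnegative integers; see `A-correct` and `b-correct`.
asℕ : ℚ → ℕ
asℕ q = ℤ.∣ ↥ q ∣

-- "q is an integer divisible by d": integrality of q is part of the relation.
infix 4 _divides_
_divides_ : ℕ → ℚ → Set
d divides q = IsInteger q × d ℕ.∣ ℤ.∣ ↥ q ∣

_divides?_ : ∀ d q → Dec (d divides q)
d divides? q = (↧ₙ q ℕ.≟ 1) ×-dec (d ℕ.∣? ℤ.∣ ↥ q ∣)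

-- tuples k m lists every k-tuple with entries in {0,…,m-1} exactly once.

tuples : ∀ k → ℕ → List (Vec ℕ k)
tuples zero    m = [] ∷ []
tuples (suc k) m = cartesianProductWith _∷_ (upTo m) (tuples k m)

∈-tuples⁺ : ∀ {m} (v : Vec ℕ k) → (∀ i → lookup v i ℕ.< m) → v ∈ tuples k m
∈-tuples⁺ []      _   = here refl
∈-tuples⁺ (a ∷ v) v<m = ∈.∈-cartesianProductWith⁺ _∷_
  (∈.∈-upTo⁺ (v<m zero)) (∈-tuples⁺ v (λ i → v<m (suc i)))

∈-tuples⁻ : ∀ {m} (v : Vec ℕ k) → v ∈ tuples k m → ∀ i → lookup v i ℕ.< m
∈-tuples⁻ {suc k} {m} v v∈ i
  with a , w , a∈ , w∈ , refl ← ∈.∈-cartesianProductWith⁻ _∷_ (upTo m) (tuples k m) v∈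
  with i
... | zero  = ∈.∈-upTo⁻ a∈
... | suc j = ∈-tuples⁻ w w∈ j

tuples-unique : ∀ k m → Unique (tuples k m)
tuples-unique zero    m = All.[] AllPairs.∷ AllPairs.[]
tuples-unique (suc k) m =
  Unique.cartesianProductWith⁺ _∷_ Vec.∷-injective (Unique.upTo⁺ m) (tuples-unique k m)

-- ∑[ j ≠ i ] v j
∑-except : Fin k → Vector ℚ k → ℚ
∑-except i v = ∑ λ j → if does (i Fin.≟ j) then 0ℚ else v j

Admissible : Vector ℚ k → ℕ → Vec ℕ k → Set
Admissible α g v = Vec.sum v ≡ g × (∀ i → fromℕ (lookup v i) ≤ α i * fromℕ g)

admissible? : ∀ (α : Vector ℚ k) g v → Dec (Admissible α g v)
admissible? α g v =
  (Vec.sum v ℕ.≟ g) ×-dec Fin.all? (λ i → fromℕ (lookup v i) ℚ.≤? α i * fromℕ g)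

-- Entries summing to g are at most g, so tuples k (suc g) misses nothing.
f : Vector ℚ k → ℕ → ℕ
f {k} α g = length (filter (admissible? α g) (tuples k (suc g)))

F : Vector ℚ k → PowerSeries
F α g = + f α g

module _ (α : Vector ℚ k) where

  n : Fin k → ℕ
  n i = ↧ₙ α i

  N : ℕ
  N = ∏ℕ n

  Aℚ : ℚ
  Aℚ = fromℕ N * (∑ α - 1ℚ)

  A : ℕ
  A = asℕ Aℚ

  α̂ : Fin k → ℚ
  α̂ i = 1ℚ - ∑-except i α

  a/n : Vec ℕ k → Vector ℚ k
  a/n a i = + lookup a i / n i

  form : Vec ℕ k → Fin k → ℚ
  form a j = fromℕ N * α̂ j * a/n a j + fromℕ N * α j * ∑-except j (a/n a)

  𝒜-condition : Vec ℕ k → Set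
  𝒜-condition a = ∀ j → A divides form a j

  𝒜-condition? : ∀ a → Dec (𝒜-condition a)
  𝒜-condition? a = Fin.all? λ j → A divides? form a j

  𝒜 : List (Vec ℕ k)
  𝒜 = filter 𝒜-condition? (tuples k A)

  -- The division is exact, by ∣∏ℕ.
  denominator : PowerSeries
  denominator = ∏ₚ λ i → 1-x^ (N ℕ./ n i)

  module _ .{{_ : NonZero Aℚ}} where

    bℚ : Vec ℕ k → ℚ
    bℚ a = (fromℕ N ÷ Aℚ) * ∑ (a/n a)

    b : Vec ℕ k → ℕ
    b a = asℕ (bℚ a)

    numerator : PowerSeries
    numerator = ∑ₚ (List.map (λ a → x^ b a) 𝒜)

-- What follows shows that asℕ is only ever applied to nonnegative integers.

/1-+ : ∀ x y → x / 1 + y / 1 ≡ (x ℤ.+ y) / 1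
/1-+ x y = ℚ.toℚᵘ-injective (begin
  toℚᵘ (x / 1 + y / 1)             ≈⟨ ℚ.toℚᵘ-homo-+ (x / 1) (y / 1) ⟩
  toℚᵘ (x / 1) ℚᵘ.+ toℚᵘ (y / 1)   ≈⟨ ℚᵘ.+-cong (ℚ.toℚᵘ-fromℚᵘ (ℚᵘ.mkℚᵘ x 0)) (ℚ.toℚᵘ-fromℚᵘ (ℚᵘ.mkℚᵘ y 0)) ⟩
  ℚᵘ.mkℚᵘ x 0 ℚᵘ.+ ℚᵘ.mkℚᵘ y 0     ≡⟨ cong (λ z → ℚᵘ.mkℚᵘ z 0) (cong₂ ℤ._+_ (ℤ.*-identityʳ x) (ℤ.*-identityʳ y)) ⟩
  ℚᵘ.mkℚᵘ (x ℤ.+ y) 0              ≈⟨ ℚ.toℚᵘ-fromℚᵘ (ℚᵘ.mkℚᵘ (x ℤ.+ y) 0) ⟨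
  toℚᵘ ((x ℤ.+ y) / 1)             ∎)
  where open ℚᵘ.≃-Reasoning

/1-* : ∀ x y → x / 1 * (y / 1) ≡ (x ℤ.* y) / 1
/1-* x y = ℚ.toℚᵘ-injective (begin
  toℚᵘ (x / 1 * (y / 1))           ≈⟨ ℚ.toℚᵘ-homo-* (x / 1) (y / 1) ⟩
  toℚᵘ (x / 1) ℚᵘ.* toℚᵘ (y / 1)   ≈⟨ ℚᵘ.*-cong (ℚ.toℚᵘ-fromℚᵘ (ℚᵘ.mkℚᵘ x 0)) (ℚ.toℚᵘ-fromℚᵘ (ℚᵘ.mkℚᵘ y 0)) ⟩
  ℚᵘ.mkℚᵘ (x ℤ.* y) 0              ≈⟨ ℚ.toℚᵘ-fromℚᵘ (ℚᵘ.mkℚᵘ (x ℤ.* y) 0) ⟨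
  toℚᵘ ((x ℤ.* y) / 1)             ∎)
  where open ℚᵘ.≃-Reasoning

/1-isInteger : ∀ x → IsInteger (x / 1)
/1-isInteger x = cong ↧ₙ_ (ℚ.↥p/↧p≡p (mkℚ x 0 (Coprime.sym (Coprime.1-coprimeTo _))))

isInteger⇒/1 : ∀ q → IsInteger q → q ≡ ↥ q / 1
isInteger⇒/1 q q∈ℤ = trans (sym (ℚ.↥p/↧p≡p q)) (ℚ./-cong {↥ q} refl q∈ℤ)

asℕ-correct : ∀ {q} → 0ℚ ≤ q → IsInteger q → fromℕ (asℕ q) ≡ q
asℕ-correct {q@record{}} 0≤q q∈ℤ = trans
  (cong (_/ 1) (ℤ.0≤i⇒+∣i∣≡i (ℤ.nonNegative⁻¹ (↥ q) {{nonNegative 0≤q}})))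
  (sym (isInteger⇒/1 q q∈ℤ))

+-isInteger : ∀ p q → IsInteger p → IsInteger q → IsInteger (p + q)
+-isInteger p q p∈ℤ q∈ℤ = subst IsInteger
  (sym (trans (cong₂ _+_ (isInteger⇒/1 p p∈ℤ) (isInteger⇒/1 q q∈ℤ)) (/1-+ (↥ p) (↥ q))))
  (/1-isInteger (↥ p ℤ.+ ↥ q))

*-isInteger : ∀ p q → IsInteger p → IsInteger q → IsInteger (p * q)
*-isInteger p q p∈ℤ q∈ℤ = subst IsInteger
  (sym (trans (cong₂ _*_ (isInteger⇒/1 p p∈ℤ) (isInteger⇒/1 q q∈ℤ)) (/1-* (↥ p) (↥ q))))
  (/1-isInteger (↥ p ℤ.* ↥ q))

∑-isInteger : (v : Vector ℚ k) → (∀ i → IsInteger (v i)) → IsInteger (∑ v)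
∑-isInteger {zero}  v _   = refl
∑-isInteger {suc k} v v∈ℤ =
  +-isInteger (v zero) _ (v∈ℤ zero) (∑-isInteger (λ i → v (suc i)) (λ i → v∈ℤ (suc i)))

∑-nonNeg : (v : Vector ℚ k) → (∀ i → 0ℚ ≤ v i) → 0ℚ ≤ ∑ v
∑-nonNeg {zero}  v _   = ℚ.≤-refl
∑-nonNeg {suc k} v 0≤v =
  ℚ.+-mono-≤ (0≤v zero) (∑-nonNeg (λ i → v (suc i)) (λ i → 0≤v (suc i)))

/-nonNeg : ∀ m d .{{_ : ℕ.NonZero d}} → 0ℚ ≤ + m / d
/-nonNeg m d = ℚ.nonNegative⁻¹ (+ m / d) {{ℚ.normalize-nonNeg m d}}

1/-nonNeg : ∀ p .{{_ : NonZero p}} → Positive p → 0ℚ ≤ 1/ p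
1/-nonNeg p@(mkℚ ℤ.+[1+ _ ] _ _) _ = ℚ.nonNegative⁻¹ (1/ p)

∣∏ℕ : (v : Vector ℕ k) (i : Fin k) → v i ℕ.∣ ∏ℕ v
∣∏ℕ v zero    = ℕ.m∣m*n _
∣∏ℕ v (suc i) = ℕ.∣n⇒∣m*n (v zero) (∣∏ℕ (λ j → v (suc j)) i)

∏ℕ-nonZero : (v : Vector ℕ k) → (∀ i → ℕ.NonZero (v i)) → ℕ.NonZero (∏ℕ v)
∏ℕ-nonZero {zero}  v _   = _
∏ℕ-nonZero {suc k} v v≢0 = ℕ.m*n≢0 (v zero) _
  {{v≢0 zero}} {{∏ℕ-nonZero (λ i → v (suc i)) (λ i → v≢0 (suc i))}}

∑-except-correct : ∀ (i : Fin k) v → ∑-except i v ≡ ∑ v - v i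
∑-except-correct {suc k} zero v =
  solve 2 (λ x s → con 0ℚ :+ s := (x :+ s) :- x) refl (v zero) (∑ (λ j → v (suc j)))
  where open +-*-Solver
∑-except-correct {suc k} (suc i) v = trans
  (cong (λ s → v zero + s) (∑-except-correct i (λ j → v (suc j))))
  (sym (ℚ.+-assoc (v zero) _ _))

↧ₙ*p≡↥p : ∀ p → fromℕ (↧ₙ p) * p ≡ ↥ p / 1
↧ₙ*p≡↥p p@(mkℚ x d-1 _) = ℚ.toℚᵘ-injective (begin
  toℚᵘ (fromℕ (suc d-1) * p)                ≈⟨ ℚ.toℚᵘ-homo-* (fromℕ (suc d-1)) p ⟩
  toℚᵘ (fromℕ (suc d-1)) ℚᵘ.* toℚᵘ p        ≈⟨ ℚᵘ.*-congʳ (ℚ.toℚᵘ-fromℚᵘ (ℚᵘ.mkℚᵘ (+ suc d-1) 0)) ⟩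
  ℚᵘ.mkℚᵘ (+ suc d-1) 0 ℚᵘ.* toℚᵘ p         ≈⟨ ℚᵘ.*≡* lemma ⟩
  ℚᵘ.mkℚᵘ x 0                               ≈⟨ ℚ.toℚᵘ-fromℚᵘ (ℚᵘ.mkℚᵘ x 0) ⟨
  toℚᵘ (x / 1)                              ∎)
  where
  open ℚᵘ.≃-Reasoning
  lemma : (+ suc d-1 ℤ.* x) ℤ.* + 1 ≡ x ℤ.* + (1 ℕ.* suc d-1)
  lemma = trans (ℤ.*-identityʳ _) (trans (ℤ.*-comm (+ suc d-1) x)
    (cong (λ e → x ℤ.* + e) (sym (ℕ.*-identityˡ (suc d-1)))))

module _ (α : Vector ℚ k) where

  N*α-isInteger : ∀ i → IsInteger (fromℕ (N α) * α i)
  N*α-isInteger i with ℕ.divides c N≡c*n ← ∣∏ℕ (n α) i = subst IsInteger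
    (begin
      fromℕ c * (↥ (α i) / 1)            ≡⟨ cong (fromℕ c *_) (↧ₙ*p≡↥p (α i)) ⟨
      fromℕ c * (fromℕ (n α i) * α i)    ≡⟨ ℚ.*-assoc (fromℕ c) _ _ ⟨
      fromℕ c * fromℕ (n α i) * α i      ≡⟨ cong (_* α i) (/1-* (+ c) (+ n α i)) ⟩
      (+ c ℤ.* + n α i) / 1 * α i        ≡⟨ cong (λ z → z / 1 * α i) (ℤ.pos-* c (n α i)) ⟨
      fromℕ (c ℕ.* n α i) * α i          ≡⟨ cong (λ m → fromℕ m * α i) N≡c*n ⟨
      fromℕ (N α) * α i                  ∎)
    (*-isInteger (fromℕ c) (↥ (α i) / 1) (/1-isInteger (+ c)) (/1-isInteger (↥ (α i))))
    where open ≡-Reasoning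

  Aℚ-isInteger : IsInteger (Aℚ α)
  Aℚ-isInteger = subst IsInteger
    (begin
      ∑ (λ i → fromℕ (N α) * α i) + fromℕ (N α) * (- 1ℚ)  ≡⟨ cong (_+ fromℕ (N α) * (- 1ℚ)) (∑ℚ.*-distribˡ-sum (fromℕ (N α)) α) ⟨
      fromℕ (N α) * ∑ α + fromℕ (N α) * (- 1ℚ)            ≡⟨ ℚ.*-distribˡ-+ (fromℕ (N α)) (∑ α) (- 1ℚ) ⟨
      Aℚ α                                                ∎)
    (+-isInteger (∑ (λ i → fromℕ (N α) * α i)) (fromℕ (N α) * (- 1ℚ)) (∑-isInteger _ N*α-isInteger)
      (*-isInteger (fromℕ (N α)) (- 1ℚ) (/1-isInteger (+ N α)) refl))
    where open ≡-Reasoning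

  Aℚ-positive : 1ℚ < ∑ α → Positive (Aℚ α)
  Aℚ-positive 1<∑α = ℚ.pos*pos⇒pos
    (fromℕ (N α)) {{ℚ.normalize-pos (N α) 1 {{_}} {{∏ℕ-nonZero (n α) _}}}}
    (∑ α - 1ℚ)    {{positive (subst (_< ∑ α - 1ℚ) (ℚ.+-inverseʳ 1ℚ) (ℚ.+-monoˡ-< (- 1ℚ) 1<∑α))}}

  Aℚ-nonZero : 1ℚ < ∑ α → NonZero (Aℚ α)
  Aℚ-nonZero 1<∑α = ℚ.pos⇒nonZero (Aℚ α) {{Aℚ-positive 1<∑α}}

  A-correct : 1ℚ < ∑ α → fromℕ (A α) ≡ Aℚ α
  A-correct 1<∑α = asℕ-correct
    (ℚ.<⇒≤ (ℚ.positive⁻¹ (Aℚ α) {{Aℚ-positive 1<∑α}})) Aℚ-isInteger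

  ∑-form : ∀ a → ∑ (form α a) ≡ fromℕ (N α) * ∑ (a/n α a)
  ∑-form a = begin
    ∑ (form α a)
      ≡⟨ ∑ℚ.sum-cong-≗ pointwise ⟩
    ∑ (λ j → M * (1ℚ - S) * u j + M * U * α j)
      ≡⟨ ∑ℚ.∑-distrib-+ (λ j → M * (1ℚ - S) * u j) (λ j → M * U * α j) ⟩
    ∑ (λ j → M * (1ℚ - S) * u j) + ∑ (λ j → M * U * α j)
      ≡⟨ cong₂ _+_ (∑ℚ.*-distribˡ-sum (M * (1ℚ - S)) u) (∑ℚ.*-distribˡ-sum (M * U) α) ⟨
    M * (1ℚ - S) * U + M * U * S
      ≡⟨ solve 3 (λ M S U → M :* (con 1ℚ :- S) :* U :+ M :* U :* S := M :* U) refl M S U ⟩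
    M * U ∎
    where
    open ≡-Reasoning
    open +-*-Solver
    M = fromℕ (N α)
    S = ∑ α
    u = a/n α a
    U = ∑ u
    pointwise : ∀ j → form α a j ≡ M * (1ℚ - S) * u j + M * U * α j
    pointwise j = trans
      (cong₂ (λ s t → M * (1ℚ - s) * u j + M * α j * t)
        (∑-except-correct j α) (∑-except-correct j u))
      (solve 5 (λ M S U x y →
          M :* (con 1ℚ :- (S :- x)) :* y :+ M :* x :* (U :- y)
          := M :* (con 1ℚ :- S) :* y :+ M :* U :* x)
        refl M S U (α j) (u j))

  ÷-isInteger : 1ℚ < ∑ α → .{{_ : NonZero (Aℚ α)}} →
                ∀ q → A α divides q → IsInteger (q ÷ Aℚ α)
  ÷-isInteger 1<∑α q (q∈ℤ , A∣q)
    with ℕ.divides c ∣q∣≡c*A ← A∣q = subst IsInteger eq (/1-isInteger z)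
    where
    open ≡-Reasoning
    open import Data.Integer.Divisibility.Signed as ℤ∣ using ()
    A∣↥q = ℤ∣.∣ᵤ⇒∣ {+ A α} {↥ q} A∣q
    z = ℤ∣._∣_.quotient A∣↥q
    eq : z / 1 ≡ q ÷ Aℚ α
    eq = begin
      z / 1                              ≡⟨ ℚ.*-identityʳ (z / 1) ⟨
      z / 1 * 1ℚ                         ≡⟨ cong (z / 1 *_) (ℚ.*-inverseʳ (Aℚ α)) ⟨
      z / 1 * (Aℚ α * 1/ Aℚ α)           ≡⟨ ℚ.*-assoc (z / 1) _ _ ⟨
      z / 1 * Aℚ α * 1/ Aℚ α             ≡⟨ cong (λ w → z / 1 * w * 1/ Aℚ α) (A-correct 1<∑α) ⟨
      z / 1 * fromℕ (A α) * 1/ Aℚ α      ≡⟨ cong (_* 1/ Aℚ α) (/1-* z (+ A α)) ⟩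
      (z ℤ.* + A α) / 1 * 1/ Aℚ α        ≡⟨ cong (λ w → w / 1 * 1/ Aℚ α) (ℤ∣._∣_.equality A∣↥q) ⟨
      ↥ q / 1 * 1/ Aℚ α                  ≡⟨ cong (_* 1/ Aℚ α) (isInteger⇒/1 q q∈ℤ) ⟨
      q ÷ Aℚ α                           ∎

  b-correct : 1ℚ < ∑ α → .{{_ : NonZero (Aℚ α)}} →
              ∀ a → 𝒜-condition α a → fromℕ (b α a) ≡ bℚ α a
  b-correct 1<∑α a a∈𝒜 = asℕ-correct nonNeg (subst IsInteger eq
    (∑-isInteger (λ j → form α a j ÷ Aℚ α) (λ j → ÷-isInteger 1<∑α (form α a j) (a∈𝒜 j))))
    where
    open ≡-Reasoning
    open +-*-Solver
    eq : ∑ (λ j → form α a j ÷ Aℚ α) ≡ bℚ α a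
    eq = begin
      ∑ (λ j → form α a j * 1/ Aℚ α)         ≡⟨ ∑ℚ.*-distribʳ-sum (1/ Aℚ α) (form α a) ⟨
      ∑ (form α a) * 1/ Aℚ α                 ≡⟨ cong (_* 1/ Aℚ α) (∑-form a) ⟩
      fromℕ (N α) * ∑ (a/n α a) * 1/ Aℚ α    ≡⟨ solve 3 (λ x y z → x :* y :* z := x :* z :* y) refl
                                                  (fromℕ (N α)) (∑ (a/n α a)) (1/ Aℚ α) ⟩
      bℚ α a                                 ∎
    *-nonNeg : ∀ {p q} → 0ℚ ≤ p → 0ℚ ≤ q → 0ℚ ≤ p * q
    *-nonNeg {p} {q} 0≤p 0≤q = subst (_≤ p * q) (ℚ.*-zeroʳ p)
      (ℚ.*-monoˡ-≤-nonNeg p {{nonNegative 0≤p}} 0≤q)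
    nonNeg : 0ℚ ≤ bℚ α a
    nonNeg = *-nonNeg
      (*-nonNeg (/-nonNeg (N α) 1)
        (1/-nonNeg (Aℚ α) (Aℚ-positive 1<∑α)))
      (∑-nonNeg (a/n α a) (λ i → /-nonNeg (lookup a i) (n α i)))

{-# OPTIONS --safe #-}

-- Record an admissible tuple v of sum g by its slacks cᵢ = nᵢ(αᵢ g − vᵢ) ∈ ℕ.
-- Summing vᵢ + cᵢ/nᵢ = αᵢ g over i recovers g = (N/A) ∑ cᵢ/nᵢ, and then
-- A vⱼ is the form of the statement at c; so F counts the c ∈ ℕᵏ satisfying the
-- condition of 𝒜 by b(c).  That condition is invariant under c ↦ c + A eᵢ, which
-- raises b by N/nᵢ.  Multiplying by 1 − x^(N/nᵢ) therefore telescopes the sum over cᵢ to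
-- 0 ≤ cᵢ < A.  All sums are kept finite: coefficient n only sees c ∈ [0, (n+1)A)ᵏ.

module Submission where

open import Defs
import Algebra.Bundles
import Algebra.Properties.Group as GroupProperties
import Algebra.Properties.Semiring.Sum as SemiringSum
open import Data.Bool.Base using (if_then_else_; true; false)
open import Data.Fin.Base using (Fin; zero; suc)
import Data.Fin.Properties as Fin
open import Data.Integer.Base as ℤ using (+_; 0ℤ; 1ℤ; -1ℤ)
import Data.Integer.Divisibility.Signed as ℤ∣
import Data.Integer.Properties as ℤ
import Data.Integer.Tactic.RingSolver as ℤRing
open import Data.List.Base as List
  using ([]; _∷_; _++_; upTo; applyUpTo; cartesianProductWith; filter; length)
open import Data.List.Membership.Propositional using (_∈_)
import Data.List.Membership.Propositional.Properties as ∈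
open import Data.List.Membership.Propositional.Properties.WithK using (unique∧set⇒bag)
import Data.List.Properties as List
open import Data.List.Relation.Binary.BagAndSetEquality using (∼bag⇒↭)
open import Data.List.Relation.Binary.Permutation.Propositional.Properties using (↭-length)
import Data.List.Relation.Unary.All as All
import Data.List.Relation.Unary.All.Properties as All
open import Data.List.Relation.Unary.AllPairs using ([]; _∷_)
open import Data.List.Relation.Unary.Any using (here; there)
open import Data.List.Relation.Unary.Unique.Propositional using (Unique)
import Data.List.Relation.Unary.Unique.Propositional.Properties as Unique
open import Data.Nat.Base as ℕ using (ℕ; zero; suc; z≤n; s≤s)
import Data.Nat.Coprimality as Coprime
import Data.Nat.DivMod as ℕ
import Data.Nat.Divisibility as ℕ
import Data.Nat.Properties as ℕ
open import Data.Product.Base using (∃-syntax; _×_; _,_; proj₁; proj₂)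
open import Data.Rational.Base
  using (ℚ; 1ℚ; 0ℚ; _/_; ↥_; ↧_; _+_; _-_; -_; _*_; 1/_; _≤_; _<_; NonZero; nonNegative; mkℚ; toℚᵘ)
import Data.Rational.Properties as ℚ
open import Data.Rational.Solver using (module +-*-Solver)
import Data.Rational.Unnormalised.Base as ℚᵘ
import Data.Rational.Unnormalised.Properties as ℚᵘ
open import Data.Vec.Base as Vec using (Vec; []; _∷_; lookup; tabulate; updateAt)
open import Data.Vec.Functional using (Vector)
import Data.Vec.Properties as Vec
open import Function.Base using (_∘_; id)
open import Function.Bundles using (mk⇔)
open import Relation.Binary.PropositionalEquality
open import Relation.Nullary using (Dec; does; yes; no; contradiction)
open import Relation.Nullary.Decidable using (dec-true; dec-false; _×-dec_)

-- The forms arise by inverting the slack equations: with `N ∑ cᵢ/nᵢ = A b`, the j-th form equals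
-- `A (αⱼ b − cⱼ/nⱼ)`, so its divisibility by `A` is integrality of the tuple being reconstructed.
-- The bound on sums of k - 1 entries makes `α̂ⱼ` nonnegative, and with `αⱼ ≥ 0` this makes the
-- integral quotient a natural number.
--
-- Invariance under translation is an integrality question about `N/nᵢ` times `αⱼ`. For j ≠ i it is
-- settled by `nᵢ nⱼ ∣ N`, which relies on `N` being the full product; a least common multiple need
-- not have this property. For j = i that product may fail to be an integer, and the increment has
-- to be rewritten through the off-diagonal products.
--
-- Restricting to a finite box leaves a boundary term when the sum telescopes. Since every `N/nᵢ` is
-- at least 1, that term only has degrees above n once each side of the box holds n + 1 periods.
-- Hence the equalities between series are carried as equalities of coefficients up to a bound.

private
  module ∑ℚ = SemiringSum (Algebra.Bundles.CommutativeRing.semiring ℚ.+-*-commutativeRing)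
  variable
    k : ℕ
    X Y Z : Set

-- Power series

tail : PowerSeries → PowerSeries
tail p n = p (suc n)

-- The bound is placed on the left factor because that is where box sums stand, and these agree with
-- their limits only in low degrees.
⊛-cong-≤ : ∀ n {p p′ q q′ : PowerSeries} → (∀ m → m ℕ.≤ n → p m ≡ p′ m) → q ≈ q′ →
           (p ⊛ q) n ≡ (p′ ⊛ q′) n
⊛-cong-≤ zero    p≡ q≈ = cong₂ (λ x y → x ℤ.* y ℤ.+ 0ℤ) (p≡ 0 z≤n) (q≈ 0)
⊛-cong-≤ (suc n) p≡ q≈ = cong₂ ℤ._+_
  (cong₂ ℤ._*_ (p≡ 0 z≤n) (q≈ (suc n)))
  (⊛-cong-≤ n (λ m m≤n → p≡ (suc m) (s≤s m≤n)) q≈)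

⊛-cong : ∀ {p p′ q q′} → p ≈ p′ → q ≈ q′ → p ⊛ q ≈ p′ ⊛ q′
⊛-cong p≈ q≈ n = ⊛-cong-≤ n (λ m _ → p≈ m) q≈

-- The combination `x p + q` is the shape of the tail of a product: `tail (p ⊛ q)` unfolds to `p 0`
-- times `tail q` plus `tail p ⊛ q`. This is what the induction for associativity meets.
⊛-linearˡ : ∀ x p q r n →
  ((λ m → x ℤ.* p m ℤ.+ q m) ⊛ r) n ≡ x ℤ.* (p ⊛ r) n ℤ.+ (q ⊛ r) n
⊛-linearˡ x p q r zero    = lemma x (p 0) (q 0) (r 0)
  where
  lemma : ∀ x p q r → (x ℤ.* p ℤ.+ q) ℤ.* r ℤ.+ 0ℤ ≡ x ℤ.* (p ℤ.* r ℤ.+ 0ℤ) ℤ.+ (q ℤ.* r ℤ.+ 0ℤ)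
  lemma = ℤRing.solve-∀
⊛-linearˡ x p q r (suc n) = trans
  (cong (ℤ._+_ ((x ℤ.* p 0 ℤ.+ q 0) ℤ.* r (suc n))) (⊛-linearˡ x (tail p) (tail q) r n))
  (lemma x (p 0) (q 0) (r (suc n)) _ _)
  where
  lemma : ∀ x p q r s t → (x ℤ.* p ℤ.+ q) ℤ.* r ℤ.+ (x ℤ.* s ℤ.+ t)
        ≡ x ℤ.* (p ℤ.* r ℤ.+ s) ℤ.+ (q ℤ.* r ℤ.+ t)
  lemma = ℤRing.solve-∀

⊛-distribʳ : ∀ p q r → (p ⊕ q) ⊛ r ≈ p ⊛ r ⊕ q ⊛ r
⊛-distribʳ p q r n = begin
  ((p ⊕ q) ⊛ r) n                             ≡⟨ ⊛-cong {q = r} (λ m → cong (ℤ._+ q m) (sym (ℤ.*-identityˡ (p m)))) (λ _ → refl) n ⟩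
  ((λ m → 1ℤ ℤ.* p m ℤ.+ q m) ⊛ r) n          ≡⟨ ⊛-linearˡ 1ℤ p q r n ⟩
  1ℤ ℤ.* (p ⊛ r) n ℤ.+ (q ⊛ r) n              ≡⟨ cong (ℤ._+ (q ⊛ r) n) (ℤ.*-identityˡ ((p ⊛ r) n)) ⟩
  (p ⊛ r) n ℤ.+ (q ⊛ r) n                     ∎
  where open ≡-Reasoning

⊛-assoc : ∀ p q r → (p ⊛ q) ⊛ r ≈ p ⊛ (q ⊛ r)
⊛-assoc p q r zero    = lemma (p 0) (q 0) (r 0)
  where
  lemma : ∀ p q r → (p ℤ.* q ℤ.+ 0ℤ) ℤ.* r ℤ.+ 0ℤ ≡ p ℤ.* (q ℤ.* r ℤ.+ 0ℤ) ℤ.+ 0ℤ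
  lemma = ℤRing.solve-∀
⊛-assoc p q r (suc n) = trans
  (cong (ℤ._+_ ((p ⊛ q) 0 ℤ.* r (suc n))) (trans
    (⊛-linearˡ (p 0) (tail q) (tail p ⊛ q) r n)
    (cong (ℤ._+_ (p 0 ℤ.* (tail q ⊛ r) n)) (⊛-assoc (tail p) q r n))))
  (lemma (p 0) (q 0) (r (suc n)) _ _)
  where
  lemma : ∀ p q r s t → (p ℤ.* q ℤ.+ 0ℤ) ℤ.* r ℤ.+ (p ℤ.* s ℤ.+ t) ≡ p ℤ.* (q ℤ.* r ℤ.+ s) ℤ.+ t
  lemma = ℤRing.solve-∀

-- The convolution unfolds by recursion on its left factor only; peeling from the other end supplies
-- the mirror image that commutativity needs.
⊛-peelʳ : ∀ p q n → (p ⊛ q) (suc n) ≡ q 0 ℤ.* p (suc n) ℤ.+ (p ⊛ tail q) n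
⊛-peelʳ p q zero    = lemma (p 0) (p 1) (q 0) (q 1)
  where
  lemma : ∀ p p′ q q′ → p ℤ.* q′ ℤ.+ (p′ ℤ.* q ℤ.+ 0ℤ) ≡ q ℤ.* p′ ℤ.+ (p ℤ.* q′ ℤ.+ 0ℤ)
  lemma = ℤRing.solve-∀
⊛-peelʳ p q (suc n) = trans
  (cong (ℤ._+_ (p 0 ℤ.* q (2 ℕ.+ n))) (⊛-peelʳ (tail p) q n))
  (lemma (p 0 ℤ.* q (2 ℕ.+ n)) (q 0 ℤ.* p (2 ℕ.+ n)) _)
  where
  lemma : ∀ x y z → x ℤ.+ (y ℤ.+ z) ≡ y ℤ.+ (x ℤ.+ z)
  lemma = ℤRing.solve-∀

⊛-comm : ∀ p q → p ⊛ q ≈ q ⊛ p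
⊛-comm p q zero    = cong (ℤ._+ 0ℤ) (ℤ.*-comm (p 0) (q 0))
⊛-comm p q (suc n) = trans
  (cong (ℤ._+_ (p 0 ℤ.* q (suc n))) (⊛-comm (tail p) q n))
  (sym (⊛-peelʳ q p n))

0ₚ-⊛ : ∀ p → 0ₚ ⊛ p ≈ 0ₚ
0ₚ-⊛ p zero    = refl
0ₚ-⊛ p (suc n) = trans (ℤ.+-identityˡ _) (0ₚ-⊛ p n)

-- Multiplication by `x^ m`, encoded so that it computes on constructors instead of unfolding a
-- convolution.
shift : ℕ → PowerSeries → PowerSeries
shift zero    p n       = p n
shift (suc m) p zero    = 0ℤ
shift (suc m) p (suc n) = shift m p n

x^-⊛ : ∀ m p → x^ m ⊛ p ≈ shift m p
x^-⊛ zero p zero     = trans (ℤ.+-identityʳ _) (ℤ.*-identityˡ (p 0))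
x^-⊛ zero p (suc n)  = trans
  (cong₂ ℤ._+_ (ℤ.*-identityˡ (p (suc n))) (0ₚ-⊛ p n)) (ℤ.+-identityʳ _)
x^-⊛ (suc m) p zero    = refl
x^-⊛ (suc m) p (suc n) = trans (ℤ.+-identityˡ _) (x^-⊛ m p n)

1-x^-⊛ : ∀ m p → (1-x^ m) ⊛ p ≈ λ n → p n ℤ.- shift m p n
1-x^-⊛ m p n = begin
  ((1-x^ m) ⊛ p) n
    ≡⟨ ⊛-cong {q = p} (λ i → lemma (1ₚ i) ((x^ m) i)) (λ _ → refl) n ⟩
  ((λ i → -1ℤ ℤ.* (x^ m) i ℤ.+ 1ₚ i) ⊛ p) n
    ≡⟨ ⊛-linearˡ -1ℤ (x^ m) 1ₚ p n ⟩
  -1ℤ ℤ.* (x^ m ⊛ p) n ℤ.+ (1ₚ ⊛ p) n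
    ≡⟨ cong₂ (λ s t → -1ℤ ℤ.* s ℤ.+ t) (x^-⊛ m p n) (x^-⊛ 0 p n) ⟩
  -1ℤ ℤ.* shift m p n ℤ.+ p n
    ≡⟨ lemma (p n) (shift m p n) ⟨
  p n ℤ.- shift m p n ∎
  where
  open ≡-Reasoning
  lemma : ∀ x y → x ℤ.- y ≡ -1ℤ ℤ.* y ℤ.+ x
  lemma = ℤRing.solve-∀

shift-cong : ∀ m {p q} → p ≈ q → shift m p ≈ shift m q
shift-cong zero    p≈q n       = p≈q n
shift-cong (suc m) p≈q zero    = refl
shift-cong (suc m) p≈q (suc n) = shift-cong m p≈q n

shift-0ₚ : ∀ m → shift m 0ₚ ≈ 0ₚ
shift-0ₚ zero    n       = refl
shift-0ₚ (suc m) zero    = refl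
shift-0ₚ (suc m) (suc n) = shift-0ₚ m n

shift-⊕ : ∀ m p q → shift m (p ⊕ q) ≈ shift m p ⊕ shift m q
shift-⊕ zero    p q n       = refl
shift-⊕ (suc m) p q zero    = refl
shift-⊕ (suc m) p q (suc n) = shift-⊕ m p q n

shift-x^ : ∀ m l → shift m (x^ l) ≈ x^ (m ℕ.+ l)
shift-x^ zero    l n       = refl
shift-x^ (suc m) l zero    = refl
shift-x^ (suc m) l (suc n) = shift-x^ m l n

-- A shift by a positive amount is contractive: it gains one degree of agreement. The inductions on
-- the number of periods run on this gain.
shift-cong-≤ : ∀ m .{{_ : ℕ.NonZero m}} {p q : PowerSeries} n → (∀ i → i ℕ.< n → p i ≡ q i) →
               shift m p n ≡ shift m q n
shift-cong-≤ (suc m)       zero    p≡q = refl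
shift-cong-≤ (suc zero)    (suc n) p≡q = p≡q n ℕ.≤-refl
shift-cong-≤ (suc (suc m)) (suc n) p≡q =
  shift-cong-≤ (suc m) n (λ i i<n → p≡q i (ℕ.m<n⇒m<1+n i<n))

shift-< : ∀ m p {n} → n ℕ.< m → shift m p n ≡ 0ℤ
shift-< (suc m) p {zero}  _         = refl
shift-< (suc m) p {suc n} (s≤s n<m) = shift-< m p n<m

shift-+ : ∀ m p n → shift m p (m ℕ.+ n) ≡ p n
shift-+ zero    p n = refl
shift-+ (suc m) p n = shift-+ m p n

-- Invertibility of the denominator

geometric : ℕ → PowerSeries
geometric m n = if does (m ℕ.∣? n) then 1ℤ else 0ℤ

-- Divisibility by `m` is `m`-periodic, so everything from degree `m` on cancels against the shift;
-- below `m` the shift vanishes and only 0 is divisible by `m`.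
1-x^-⊛-geometric : ∀ m .{{_ : ℕ.NonZero m}} → (1-x^ m) ⊛ geometric m ≈ 1ₚ
1-x^-⊛-geometric m n = trans (1-x^-⊛ m (geometric m) n) (lemma (n ℕ.<? m))
  where
  lemma : _ → geometric m n ℤ.- shift m (geometric m) n ≡ 1ₚ n
  lemma (yes n<m) = trans
    (cong (ℤ._-_ (geometric m n)) (shift-< m (geometric m) n<m))
    (trans (ℤ.+-identityʳ _) (below n n<m))
    where
    below : ∀ n → n ℕ.< m → geometric m n ≡ 1ₚ n
    below zero    _   = cong (if_then 1ℤ else 0ℤ) (dec-true (m ℕ.∣? 0) (m ℕ.∣0))
    below (suc n) n<m = cong (if_then 1ℤ else 0ℤ) (dec-false (m ℕ.∣? suc n) (ℕ.>⇒∤ n<m))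
  lemma (no n≮m) with l , refl ← ℕ.m≤n⇒∃[o]m+o≡n (ℕ.≮⇒≥ n≮m) = begin
    geometric m (m ℕ.+ l) ℤ.- shift m (geometric m) (m ℕ.+ l)
      ≡⟨ cong₂ ℤ._-_ periodic (shift-+ m (geometric m) l) ⟩
    geometric m l ℤ.- geometric m l
      ≡⟨ ℤ.+-inverseʳ (geometric m l) ⟩
    0ℤ
      ≡⟨ cong (if_then 1ℤ else 0ℤ) (dec-false (m ℕ.+ l ℕ.≟ 0) (λ m+l≡0 → ℕ.≢-nonZero⁻¹ m (ℕ.m+n≡0⇒m≡0 m m+l≡0))) ⟨
    1ₚ (m ℕ.+ l) ∎
    where
    open ≡-Reasoning
    periodic : geometric m (m ℕ.+ l) ≡ geometric m l
    periodic with m ℕ.∣? l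
    ... | yes m∣l = cong (if_then 1ℤ else 0ℤ) (dec-true (m ℕ.∣? m ℕ.+ l) (ℕ.∣m∣n⇒∣m+n ℕ.∣-refl m∣l))
    ... | no  m∤l = cong (if_then 1ℤ else 0ℤ) (dec-false (m ℕ.∣? m ℕ.+ l) (λ m∣m+l → m∤l (ℕ.∣m+n∣m⇒∣n m∣m+l ℕ.∣-refl)))

Unit : PowerSeries → Set
Unit q = ∃[ r ] q ⊛ r ≈ 1ₚ

⊛-unit : ∀ p q → Unit p → Unit q → Unit (p ⊛ q)
⊛-unit p q (p⁻¹ , pp⁻¹≈1) (q⁻¹ , qq⁻¹≈1) = q⁻¹ ⊛ p⁻¹ , λ n → begin
  ((p ⊛ q) ⊛ (q⁻¹ ⊛ p⁻¹)) n   ≡⟨ ⊛-assoc p q (q⁻¹ ⊛ p⁻¹) n ⟩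
  (p ⊛ (q ⊛ (q⁻¹ ⊛ p⁻¹))) n   ≡⟨ ⊛-cong {p} (λ _ → refl) (λ m → sym (⊛-assoc q q⁻¹ p⁻¹ m)) n ⟩
  (p ⊛ ((q ⊛ q⁻¹) ⊛ p⁻¹)) n   ≡⟨ ⊛-cong {p} (λ _ → refl) (⊛-cong {q = p⁻¹} qq⁻¹≈1 (λ _ → refl)) n ⟩
  (p ⊛ (1ₚ ⊛ p⁻¹)) n          ≡⟨ ⊛-cong {p} (λ _ → refl) (x^-⊛ 0 p⁻¹) n ⟩
  (p ⊛ p⁻¹) n                 ≡⟨ pp⁻¹≈1 n ⟩
  1ₚ n                        ∎
  where open ≡-Reasoning

∏-unit : (q : Vector PowerSeries k) → (∀ i → Unit (q i)) → Unit (∏ₚ q)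
∏-unit {zero}  q _      = 1ₚ , x^-⊛ 0 1ₚ
∏-unit {suc k} q q-unit = ⊛-unit (q zero) (∏ₚ (q ∘ suc)) (q-unit zero) (∏-unit (q ∘ suc) (q-unit ∘ suc))

-- Sums of power series over lists and boxes

∑ₚ-cong : ∀ {φ ψ : X → PowerSeries} xs {n} → (∀ x → φ x n ≡ ψ x n) →
          ∑ₚ (List.map φ xs) n ≡ ∑ₚ (List.map ψ xs) n
∑ₚ-cong []       φ≡ψ = refl
∑ₚ-cong (x ∷ xs) φ≡ψ = cong₂ ℤ._+_ (φ≡ψ x) (∑ₚ-cong xs φ≡ψ)

∑ₚ-⊛ : ∀ (φ : X → PowerSeries) xs q →
       ∑ₚ (List.map φ xs) ⊛ q ≈ ∑ₚ (List.map (λ x → φ x ⊛ q) xs)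
∑ₚ-⊛ φ []       q n = 0ₚ-⊛ q n
∑ₚ-⊛ φ (x ∷ xs) q n = trans
  (⊛-distribʳ (φ x) (∑ₚ (List.map φ xs)) q n)
  (cong (ℤ._+_ ((φ x ⊛ q) n)) (∑ₚ-⊛ φ xs q n))

shift-∑ₚ : ∀ m (φ : X → PowerSeries) xs →
           shift m (∑ₚ (List.map φ xs)) ≈ ∑ₚ (List.map (λ x → shift m (φ x)) xs)
shift-∑ₚ m φ []       n = shift-0ₚ m n
shift-∑ₚ m φ (x ∷ xs) n = trans
  (shift-⊕ m (φ x) (∑ₚ (List.map φ xs)) n)
  (cong (ℤ._+_ (shift m (φ x) n)) (shift-∑ₚ m φ xs n))

∑ₚ-map-++ : ∀ (g : Y → X) (φ : X → PowerSeries) ys xs →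
  ∑ₚ (List.map φ (List.map g ys ++ xs)) ≈ ∑ₚ (List.map (φ ∘ g) ys) ⊕ ∑ₚ (List.map φ xs)
∑ₚ-map-++ g φ []       xs n = sym (ℤ.+-identityˡ _)
∑ₚ-map-++ g φ (y ∷ ys) xs n = trans
  (cong (ℤ._+_ (φ (g y) n)) (∑ₚ-map-++ g φ ys xs n)) (sym (ℤ.+-assoc (φ (g y) n) _ _))

∑ₚ-cartesianProductWith : ∀ (g : X → Y → Z) (φ : Z → PowerSeries) xs ys →
  ∑ₚ (List.map φ (cartesianProductWith g xs ys))
  ≈ ∑ₚ (List.map (λ x → ∑ₚ (List.map (λ y → φ (g x y)) ys)) xs)
∑ₚ-cartesianProductWith g φ []       ys n = refl
∑ₚ-cartesianProductWith g φ (x ∷ xs) ys n = trans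
  (∑ₚ-map-++ (g x) φ ys (cartesianProductWith g xs ys) n)
  (cong (ℤ._+_ (∑ₚ (List.map (φ ∘ g x) ys) n)) (∑ₚ-cartesianProductWith g φ xs ys n))

∑< : ℕ → (ℕ → PowerSeries) → PowerSeries
∑< m ψ = ∑ₚ (List.map ψ (upTo m))

∑<-suc : ∀ m ψ → ∑< (suc m) ψ ≈ ψ 0 ⊕ ∑< m (ψ ∘ suc)
∑<-suc m ψ n = cong (ℤ._+_ (ψ 0 n)) (lemma suc id m)
  where
  -- `upTo` is `applyUpTo id`, and each step of `applyUpTo` precomposes its function with `suc`; the
  -- induction therefore needs an arbitrary `h` in place of `id`.
  lemma : ∀ (g h : ℕ → ℕ) m → ∑ₚ (List.map ψ (applyUpTo (g ∘ h) m)) n ≡ ∑ₚ (List.map (ψ ∘ g) (applyUpTo h m)) n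
  lemma g h zero    = refl
  lemma g h (suc m) = cong (ℤ._+_ (ψ (g (h 0)) n)) (lemma g (h ∘ suc) m)

∑<-+ : ∀ l m ψ → ∑< (l ℕ.+ m) ψ ≈ ∑< l ψ ⊕ ∑< m (λ i → ψ (l ℕ.+ i))
∑<-+ zero    m ψ n = sym (ℤ.+-identityˡ _)
∑<-+ (suc l) m ψ n = begin
  ∑< (suc l ℕ.+ m) ψ n
    ≡⟨ ∑<-suc (l ℕ.+ m) ψ n ⟩
  ψ 0 n ℤ.+ ∑< (l ℕ.+ m) (ψ ∘ suc) n
    ≡⟨ cong (ℤ._+_ (ψ 0 n)) (∑<-+ l m (ψ ∘ suc) n) ⟩
  ψ 0 n ℤ.+ (∑< l (ψ ∘ suc) n ℤ.+ ∑< m (λ i → ψ (suc l ℕ.+ i)) n)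
    ≡⟨ ℤ.+-assoc (ψ 0 n) _ _ ⟨
  ψ 0 n ℤ.+ ∑< l (ψ ∘ suc) n ℤ.+ ∑< m (λ i → ψ (suc l ℕ.+ i)) n
    ≡⟨ cong (ℤ._+ ∑< m (λ i → ψ (suc l ℕ.+ i)) n) (∑<-suc l ψ n) ⟨
  ∑< (suc l) ψ n ℤ.+ ∑< m (λ i → ψ (suc l ℕ.+ i)) n ∎
  where open ≡-Reasoning

-- Telescoping a periodic sum, in one coordinate and then in all

module _ (A w : ℕ) .{{_ : ℕ.NonZero w}} (ψ : ℕ → PowerSeries)
         (periodic : ∀ c → ψ (A ℕ.+ c) ≈ shift w (ψ c)) where

  private T = λ q → ∑< (q ℕ.* A) ψ

  -- Self-similarity of a geometric progression: once the first period is split off, periodicity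
  -- turns the rest into a shifted copy of the shorter sum.
  ∑<-unroll : ∀ q → ∑< (suc q ℕ.* A) ψ ≈ ∑< A ψ ⊕ shift w (T q)
  ∑<-unroll q n = trans (∑<-+ A (q ℕ.* A) ψ n) (cong (ℤ._+_ (∑< A ψ n)) (trans
    (∑ₚ-cong (upTo (q ℕ.* A)) (λ c → periodic c n))
    (sym (shift-∑ₚ w ψ (upTo (q ℕ.* A)) n))))

  -- Unrolling both sides expresses the difference of consecutive partial sums as a shift of the
  -- previous difference, and each shift by `w ≥ 1` pushes it up by at least one degree.
  ∑<-stable : ∀ q n → n ℕ.< q → T (suc q) n ≡ T q n
  ∑<-stable (suc q) n n<1+q = trans (∑<-unroll (suc q) n) (trans
    (cong (ℤ._+_ (∑< A ψ n)) (shift-cong-≤ w n (λ i i<n →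
      ∑<-stable q i (ℕ.<-≤-trans i<n (ℕ.s≤s⁻¹ n<1+q)))))
    (sym (∑<-unroll q n)))

  -- With q + 1 periods the error left by telescoping is `shift w` of the difference between `T q`
  -- and `T (suc q)`. That difference vanishes below degree `q`, hence its shift vanishes up to and
  -- including degree `q`.
  ∑<-⊛ : ∀ q n → n ℕ.< q → (∑< (q ℕ.* A) ψ ⊛ (1-x^ w)) n ≡ ∑< A ψ n
  ∑<-⊛ (suc q) n n<1+q = begin
    (T (suc q) ⊛ (1-x^ w)) n
      ≡⟨ ⊛-comm (T (suc q)) (1-x^ w) n ⟩
    ((1-x^ w) ⊛ T (suc q)) n
      ≡⟨ 1-x^-⊛ w (T (suc q)) n ⟩
    T (suc q) n ℤ.- shift w (T (suc q)) n
      ≡⟨ cong₂ ℤ._-_ (∑<-unroll q n) (shift-cong-≤ w n (λ i i<n →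
           ∑<-stable q i (ℕ.<-≤-trans i<n (ℕ.s≤s⁻¹ n<1+q)))) ⟩
    ∑< A ψ n ℤ.+ shift w (T q) n ℤ.- shift w (T q) n
      ≡⟨ lemma (∑< A ψ n) (shift w (T q) n) ⟩
    ∑< A ψ n ∎
    where
    open ≡-Reasoning
    lemma : ∀ x y → x ℤ.+ y ℤ.- y ≡ x
    lemma = ℤRing.solve-∀

box : ∀ k → ℕ → (Vec ℕ k → PowerSeries) → PowerSeries
box k B φ = ∑ₚ (List.map φ (tuples k B))

box-suc : ∀ B (φ : Vec ℕ (suc k) → PowerSeries) →
          box (suc k) B φ ≈ ∑< B (λ c → box k B (φ ∘ (c ∷_)))
box-suc B φ = ∑ₚ-cartesianProductWith _∷_ φ (upTo B) (tuples _ B)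

-- Coordinates are cut from `q A` down to `A` one at a time, each by its own factor. While the first
-- is cut, the others still range over the large box; periodicity survives summation over them
-- because it holds for each tuple separately.
box-⊛ : ∀ A q (w : Vector ℕ k) → (∀ i → ℕ.NonZero (w i)) →
        (φ : Vec ℕ k → PowerSeries) →
        (∀ c i → φ (Vec.updateAt c i (A ℕ.+_)) ≈ shift (w i) (φ c)) →
        ∀ n → n ℕ.< q →
        (box k (q ℕ.* A) φ ⊛ ∏ₚ (λ i → 1-x^ w i)) n ≡ box k A φ n
box-⊛ {zero} A q w w≢0 φ periodic n n<q =
  trans (⊛-comm (box 0 (q ℕ.* A) φ) 1ₚ n) (x^-⊛ 0 (box 0 (q ℕ.* A) φ) n)
box-⊛ {suc k} A q w w≢0 φ periodic n n<q = begin
  (box (suc k) B φ ⊛ (1-x^ w zero ⊛ P)) n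
    ≡⟨ ⊛-assoc (box (suc k) B φ) (1-x^ w zero) P n ⟨
  ((box (suc k) B φ ⊛ (1-x^ w zero)) ⊛ P) n
    -- The one-coordinate telescoping holds only in degrees below `q`, which is enough for
    -- coefficient `n` of the product with the remaining factors.
    ≡⟨ ⊛-cong-≤ n {q = P} (λ m m≤n → trans
         (⊛-cong {q = 1-x^ w zero} (box-suc B φ) (λ _ → refl) m)
         (∑<-⊛ A (w zero) {{w≢0 zero}} (slice B) slice-periodic q m (ℕ.≤-<-trans m≤n n<q)))
         (λ _ → refl) ⟩
  (∑< A (slice B) ⊛ P) n
    ≡⟨ ∑ₚ-⊛ (slice B) (upTo A) P n ⟩
  ∑< A (λ c → slice B c ⊛ P) n
    ≡⟨ ∑ₚ-cong (upTo A) (λ c → box-⊛ A q (w ∘ suc) (w≢0 ∘ suc) (φ ∘ (c ∷_))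
         (λ v i → periodic (c ∷ v) (suc i)) n n<q) ⟩
  ∑< A (slice A) n
    ≡⟨ box-suc A φ n ⟨
  box (suc k) A φ n ∎
  where
  open ≡-Reasoning
  B = q ℕ.* A
  P = ∏ₚ (λ i → 1-x^ w (suc i))
  slice : ℕ → ℕ → PowerSeries
  slice C c = box k C (φ ∘ (c ∷_))
  slice-periodic : ∀ c → slice B (A ℕ.+ c) ≈ shift (w zero) (slice B c)
  slice-periodic c m = trans
    (∑ₚ-cong (tuples k B) (λ v → periodic (c ∷ v) zero m))
    (sym (shift-∑ₚ (w zero) (φ ∘ (c ∷_)) (tuples k B) m))

-- Rationals and divisibility

fromℕ-+ : ∀ x y → fromℕ (x ℕ.+ y) ≡ fromℕ x + fromℕ y
fromℕ-+ x y = sym (/1-+ (+ x) (+ y))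

fromℕ-* : ∀ x y → fromℕ (x ℕ.* y) ≡ fromℕ x * fromℕ y
fromℕ-* x y = trans (cong (_/ 1) (ℤ.pos-* x y)) (sym (/1-* (+ x) (+ y)))

↥-/1 : ∀ z → ↥ (z / 1) ≡ z
↥-/1 z = cong ↥_ (ℚ.↥p/↧p≡p (mkℚ z 0 (Coprime.sym (Coprime.1-coprimeTo _))))

asℕ-fromℕ : ∀ x → asℕ (fromℕ x) ≡ x
asℕ-fromℕ x = cong ℤ.∣_∣ (↥-/1 (+ x))

fromℕ-injective : ∀ {x y} → fromℕ x ≡ fromℕ y → x ≡ y
fromℕ-injective {x} {y} eq = trans (sym (asℕ-fromℕ x)) (trans (cong asℕ eq) (asℕ-fromℕ y))

fromℕ-cancel-≤ : ∀ {x y} → fromℕ x ≤ fromℕ y → x ℕ.≤ y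
fromℕ-cancel-≤ {x} {y} x≤y = ℤ.drop‿+≤+ (subst₂ ℤ._≤_ (simp x y) (simp y x) (ℚ.drop-*≤* x≤y))
  where
  simp : ∀ x y → ↥ fromℕ x ℤ.* ↧ fromℕ y ≡ + x
  simp x y = trans (cong₂ ℤ._*_ (↥-/1 (+ x)) (cong +_ (/1-isInteger (+ y)))) (ℤ.*-identityʳ (+ x))

-- Isolates the numerator as a factor, so that fractions over a fixed denominator become linear
-- expressions for the ring solver.
/≡*1/ : ∀ x d .{{_ : ℕ.NonZero d}} → + x / d ≡ fromℕ x * (+ 1 / d)
/≡*1/ x d@(suc d-1) = ℚ.toℚᵘ-injective (begin
  toℚᵘ (+ x / d)                          ≈⟨ ℚ.toℚᵘ-fromℚᵘ (ℚᵘ.mkℚᵘ (+ x) d-1) ⟩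
  ℚᵘ.mkℚᵘ (+ x) d-1                       ≈⟨ ℚᵘ.*≡* (cong₂ (λ y e → y ℤ.* + e) (sym (ℤ.*-identityʳ (+ x))) (ℕ.*-identityˡ d)) ⟩
  ℚᵘ.mkℚᵘ (+ x) 0 ℚᵘ.* ℚᵘ.mkℚᵘ (+ 1) d-1  ≈⟨ ℚᵘ.*-cong (ℚ.toℚᵘ-fromℚᵘ (ℚᵘ.mkℚᵘ (+ x) 0)) (ℚ.toℚᵘ-fromℚᵘ (ℚᵘ.mkℚᵘ (+ 1) d-1)) ⟨
  toℚᵘ (fromℕ x) ℚᵘ.* toℚᵘ (+ 1 / d)      ≈⟨ ℚ.toℚᵘ-homo-* (fromℕ x) (+ 1 / d) ⟨
  toℚᵘ (fromℕ x * (+ 1 / d))              ∎)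
  where open ℚᵘ.≃-Reasoning

d*1/d≡1 : ∀ d .{{_ : ℕ.NonZero d}} → fromℕ d * (+ 1 / d) ≡ 1ℚ
d*1/d≡1 d@(suc d-1) = trans (sym (/≡*1/ d d)) (ℚ.toℚᵘ-injective
  (ℚᵘ.≃-trans (ℚ.toℚᵘ-fromℚᵘ (ℚᵘ.mkℚᵘ (+ d) d-1)) (ℚᵘ.*≡* (ℤ.*-comm (+ d) (+ 1)))))

*-nonNeg : ∀ {p q} → 0ℚ ≤ p → 0ℚ ≤ q → 0ℚ ≤ p * q
*-nonNeg {p} {q} 0≤p 0≤q = ℚ.nonNegative⁻¹ (p * q)
  {{ℚ.nonNeg*nonNeg⇒nonNeg p {{nonNegative 0≤p}} q {{nonNegative 0≤q}}}}

*-cancelˡ-≡ : ∀ r .{{_ : NonZero r}} {p q} → r * p ≡ r * q → p ≡ q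
*-cancelˡ-≡ r {p} {q} rp≡rq = begin
  p               ≡⟨ ℚ.*-identityˡ p ⟨
  1ℚ * p          ≡⟨ cong (_* p) (ℚ.*-inverseˡ r) ⟨
  1/ r * r * p    ≡⟨ ℚ.*-assoc (1/ r) r p ⟩
  1/ r * (r * p)  ≡⟨ cong (1/ r *_) rp≡rq ⟩
  1/ r * (r * q)  ≡⟨ ℚ.*-assoc (1/ r) r q ⟨
  1/ r * r * q    ≡⟨ cong (_* q) (ℚ.*-inverseˡ r) ⟩
  1ℚ * q          ≡⟨ ℚ.*-identityˡ q ⟩
  q               ∎
  where open ≡-Reasoning

divides⇒multiple : ∀ {d} q → d divides q → ∃[ z ] q ≡ fromℕ d * (z / 1)
divides⇒multiple {d} q (q∈ℤ , d∣q) = z , (begin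
  q                  ≡⟨ isInteger⇒/1 q q∈ℤ ⟩
  ↥ q / 1            ≡⟨ cong (_/ 1) (ℤ∣._∣_.equality d∣↥q) ⟩
  (z ℤ.* + d) / 1    ≡⟨ cong (_/ 1) (ℤ.*-comm z (+ d)) ⟩
  (+ d ℤ.* z) / 1    ≡⟨ /1-* (+ d) z ⟨
  fromℕ d * (z / 1)  ∎)
  where
  open ≡-Reasoning
  d∣↥q = ℤ∣.∣ᵤ⇒∣ {+ d} {↥ q} d∣q
  z = ℤ∣._∣_.quotient d∣↥q

multiple⇒divides : ∀ d z → d divides (fromℕ d * (z / 1))
multiple⇒divides d z = subst (d divides_) (sym (/1-* (+ d) z))
  ( /1-isInteger (+ d ℤ.* z)
  , ℕ.divides ℤ.∣ z ∣ (trans (cong ℤ.∣_∣ (↥-/1 (+ d ℤ.* z))) (trans (ℤ.abs-* (+ d) z) (ℕ.*-comm d ℤ.∣ z ∣))))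

divides-+ : ∀ {d} q t → IsInteger t → d divides q → d divides (q + fromℕ d * t)
divides-+ {d} q t t∈ℤ d∣q with z , refl ← divides⇒multiple q d∣q =
  subst (d divides_) eq (multiple⇒divides d (z ℤ.+ ↥ t))
  where
  open ≡-Reasoning
  eq : fromℕ d * ((z ℤ.+ ↥ t) / 1) ≡ fromℕ d * (z / 1) + fromℕ d * t
  eq = begin
    fromℕ d * ((z ℤ.+ ↥ t) / 1)            ≡⟨ cong (fromℕ d *_) (/1-+ z (↥ t)) ⟨
    fromℕ d * (z / 1 + ↥ t / 1)            ≡⟨ cong (λ s → fromℕ d * (z / 1 + s)) (isInteger⇒/1 t t∈ℤ) ⟨
    fromℕ d * (z / 1 + t)                  ≡⟨ ℚ.*-distribˡ-+ (fromℕ d) (z / 1) t ⟩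
    fromℕ d * (z / 1) + fromℕ d * t        ∎

neg-isInteger : ∀ t → IsInteger t → IsInteger (- t)
neg-isInteger t t∈ℤ = subst IsInteger
  (trans (sym (ℚ.neg-distribˡ-* 1ℚ t)) (cong -_ (ℚ.*-identityˡ t)))
  (*-isInteger (- 1ℚ) t refl t∈ℤ)

-- Distinct positions contribute separate factors to the product. Applied to the denominators, it
-- leaves `nⱼ` inside `N / nᵢ`, which makes `N / nᵢ` times `αⱼ` an integer.
*∣∏ℕ : (v : Vector ℕ k) {i j : Fin k} → i ≢ j → v i ℕ.* v j ℕ.∣ ∏ℕ v
*∣∏ℕ v {zero}  {zero}  i≢j = contradiction refl i≢j
*∣∏ℕ v {zero}  {suc j} i≢j = ℕ.*-monoʳ-∣ (v zero) (∣∏ℕ (v ∘ suc) j)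
*∣∏ℕ v {suc i} {zero}  i≢j = subst (ℕ._∣ ∏ℕ v) (ℕ.*-comm (v zero) (v (suc i)))
  (ℕ.*-monoʳ-∣ (v zero) (∣∏ℕ (v ∘ suc) i))
*∣∏ℕ v {suc i} {suc j} i≢j = ℕ.∣n⇒∣m*n (v zero) (*∣∏ℕ (v ∘ suc) (i≢j ∘ cong suc))

single : Fin k → ℚ → Vector ℚ k
single i x j = if does (i Fin.≟ j) then x else 0ℚ

single-≡ : ∀ (i : Fin k) x → single i x i ≡ x
single-≡ i x = cong (if_then x else 0ℚ) (dec-true (i Fin.≟ i) refl)

single-≢ : ∀ {i j : Fin k} x → i ≢ j → single i x j ≡ 0ℚ
single-≢ {i = i} {j} x i≢j = cong (if_then x else 0ℚ) (dec-false (i Fin.≟ j) i≢j)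

∑-single : ∀ (i : Fin k) x → ∑ (single i x) ≡ x
∑-single {suc k} zero    x = trans (cong (_+_ x) (∑ℚ.sum-replicate-zero k)) (ℚ.+-identityʳ x)
∑-single {suc k} (suc i) x = trans (ℚ.+-identityˡ _) (∑-single i x)

∑-fromℕ : (v : Vec ℕ k) → ∑ (fromℕ ∘ lookup v) ≡ fromℕ (Vec.sum v)
∑-fromℕ []      = refl
∑-fromℕ (x ∷ v) = trans (cong (_+_ (fromℕ x)) (∑-fromℕ v)) (sym (fromℕ-+ x (Vec.sum v)))

≤-∑ : (v : Vector ℚ k) → (∀ i → 0ℚ ≤ v i) → ∀ i → v i ≤ ∑ v
≤-∑ v 0≤v zero    = subst (_≤ ∑ v) (ℚ.+-identityʳ (v zero))
  (ℚ.+-monoʳ-≤ (v zero) (∑-nonNeg (v ∘ suc) (0≤v ∘ suc)))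
≤-∑ v 0≤v (suc i) = subst (_≤ ∑ v) (ℚ.+-identityˡ (v (suc i)))
  (ℚ.+-mono-≤ (0≤v zero) (≤-∑ (v ∘ suc) (0≤v ∘ suc) i))

∑-except-nonNeg : ∀ (i : Fin k) v → (∀ j → 0ℚ ≤ v j) → 0ℚ ≤ ∑-except i v
∑-except-nonNeg i v 0≤v = ∑-nonNeg _ nonNeg
  where
  nonNeg : ∀ j → 0ℚ ≤ (if does (i Fin.≟ j) then 0ℚ else v j)
  nonNeg j with does (i Fin.≟ j)
  ... | true  = ℚ.≤-refl
  ... | false = 0≤v j

∑-except-isInteger : ∀ (i : Fin k) v → (∀ j → i ≢ j → IsInteger (v j)) → IsInteger (∑-except i v)
∑-except-isInteger i v v∈ℤ = ∑-isInteger _ isInteger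
  where
  isInteger : ∀ j → IsInteger (if does (i Fin.≟ j) then 0ℚ else v j)
  isInteger j with i Fin.≟ j
  ... | yes _  = refl
  ... | no i≢j = v∈ℤ j i≢j

lookup-≤-sum : (v : Vec ℕ k) → ∀ i → lookup v i ℕ.≤ Vec.sum v
lookup-≤-sum (x ∷ v) zero    = ℕ.m≤m+n x _
lookup-≤-sum (x ∷ v) (suc i) = ℕ.≤-trans (lookup-≤-sum v i) (ℕ.m≤n+m _ x)

lookup-ext : {v w : Vec ℕ k} → (∀ i → lookup v i ≡ lookup w i) → v ≡ w
lookup-ext {v = v} {w} eq =
  trans (sym (Vec.tabulate∘lookup v)) (trans (Vec.tabulate-cong eq) (Vec.tabulate∘lookup w))

-- Counting

map-unique : ∀ (g : X → Y) xs → (∀ {x y} → x ∈ xs → y ∈ xs → g x ≡ g y → x ≡ y) →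
             Unique xs → Unique (List.map g xs)
map-unique g []       _   _             = []
map-unique g (x ∷ xs) inj (x∉xs ∷ xs!) =
  All.map⁺ (All.tabulate λ {y} y∈xs gx≡gy →
    All.lookup x∉xs y∈xs (inj (here refl) (there y∈xs) gx≡gy))
  ∷ map-unique g xs (λ x∈ y∈ → inj (there x∈) (there y∈)) xs!

-- Duplicate-free lists with the same members are permutations of each other. Injectivity is asked
-- on members only, since `slack` passes through an absolute value and is controlled only on
-- admissible tuples.
bijection⇒length≡ : ∀ (g : X → Y) {xs ys} → Unique xs → Unique ys →
  (∀ {x y} → x ∈ xs → y ∈ xs → g x ≡ g y → x ≡ y) →
  (∀ {x} → x ∈ xs → g x ∈ ys) →
  (∀ {y} → y ∈ ys → ∃[ x ] x ∈ xs × y ≡ g x) →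
  length xs ≡ length ys
bijection⇒length≡ g {xs} {ys} xs! ys! inj into onto =
  trans (sym (List.length-map g xs)) (↭-length (∼bag⇒↭ (unique∧set⇒bag
    (map-unique g xs inj xs!) ys! (mk⇔ to from))))
  where
  to : ∀ {y} → y ∈ List.map g xs → y ∈ ys
  to y∈ with x , x∈ , refl ← ∈.∈-map⁻ g y∈ = into x∈
  from : ∀ {y} → y ∈ ys → y ∈ List.map g xs
  from y∈ with x , x∈ , refl ← onto y∈ = ∈.∈-map⁺ g x∈

∑ₚ-filter : ∀ {P : X → Set} (P? : ∀ x → Dec (P x)) (φ : X → PowerSeries) xs →
  ∑ₚ (List.map φ (filter P? xs)) ≈ ∑ₚ (List.map (λ x → if does (P? x) then φ x else 0ₚ) xs)
∑ₚ-filter P? φ []       n = refl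
∑ₚ-filter P? φ (x ∷ xs) n with does (P? x)
... | true  = cong (ℤ._+_ (φ x n)) (∑ₚ-filter P? φ xs n)
... | false = trans (∑ₚ-filter P? φ xs n) (sym (ℤ.+-identityˡ _))

∑ₚ-length : ∀ {P : X → Set} (P? : ∀ x → Dec (P x)) (φ : X → PowerSeries) n →
  (∀ x → φ x n ≡ (if does (P? x) then 1ℤ else 0ℤ)) → ∀ xs →
  ∑ₚ (List.map φ xs) n ≡ + length (filter P? xs)
∑ₚ-length P? φ n φ≡ []       = refl
∑ₚ-length P? φ n φ≡ (x ∷ xs) with does (P? x) | φ≡ x
... | true  | φx≡1 = cong₂ ℤ._+_ φx≡1 (∑ₚ-length P? φ n φ≡ xs)
... | false | φx≡0 = trans (cong₂ ℤ._+_ φx≡0 (∑ₚ-length P? φ n φ≡ xs)) (ℤ.+-identityˡ _)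

if-×-dec : ∀ {P : Set} (P? : Dec P) m n →
  (if does P? then x^ m else 0ₚ) n ≡ (if does (P? ×-dec (n ℕ.≟ m)) then 1ℤ else 0ℤ)
if-×-dec (yes _) m n = refl
if-×-dec (no _)  m n = refl

-- The relation between the exponents is asked only under `P`: outside the condition of `𝒜`, `b` may
-- be the numerator of a non-integral rational, and there both series are zero.
if-periodic : ∀ {P P′ : Set} (P? : Dec P) (P′? : Dec P′) → (P → P′) → (P′ → P) →
  ∀ w {m m′} → (P → m′ ≡ w ℕ.+ m) →
  (if does P′? then x^ m′ else 0ₚ) ≈ shift w (if does P? then x^ m else 0ₚ)
if-periodic (yes p) (yes _)  _   _   w {m} m′≡ n = trans (cong (λ l → (x^ l) n) (m′≡ p)) (sym (shift-x^ w m n))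
if-periodic (no _)  (no _)   _   _   w     _   n = sym (shift-0ₚ w n)
if-periodic (yes p) (no ¬p′) P⇒P′ _  w     _   n = contradiction (P⇒P′ p) ¬p′
if-periodic (no ¬p) (yes p′) _ P′⇒P  w     _   n = contradiction (P′⇒P p′) ¬p

-- The slack bijection

module _ (α : Vector ℚ k) where

  weight : Fin k → ℕ
  weight i = N α ℕ./ n α i

  fromℕ-weight : ∀ i → fromℕ (weight i) ≡ fromℕ (N α) * (+ 1 / n α i)
  fromℕ-weight i = begin
    fromℕ w                              ≡⟨ ℚ.*-identityʳ (fromℕ w) ⟨
    fromℕ w * 1ℚ                         ≡⟨ cong (fromℕ w *_) (d*1/d≡1 (n α i)) ⟨
    fromℕ w * (fromℕ (n α i) * ν)        ≡⟨ ℚ.*-assoc (fromℕ w) (fromℕ (n α i)) ν ⟨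
    fromℕ w * fromℕ (n α i) * ν          ≡⟨ cong (_* ν) (fromℕ-* w (n α i)) ⟨
    fromℕ (w ℕ.* n α i) * ν              ≡⟨ cong (λ x → fromℕ x * ν) (ℕ.m/n*n≡m (∣∏ℕ (n α) i)) ⟩
    fromℕ (N α) * ν                      ∎
    where
    open ≡-Reasoning
    w = weight i
    ν = + 1 / n α i

  weight-nonZero : ∀ i → ℕ.NonZero (weight i)
  weight-nonZero i = ℕ.≢-nonZero λ w≡0 → ℕ.≢-nonZero⁻¹ (N α) {{∏ℕ-nonZero (n α) _}}
    (trans (sym (ℕ.m/n*n≡m (∣∏ℕ (n α) i))) (cong (ℕ._* n α i) w≡0))

  n∣⇒*α-isInteger : ∀ {m} i → n α i ℕ.∣ m → IsInteger (fromℕ m * α i)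
  n∣⇒*α-isInteger i (ℕ.divides-refl c) = subst IsInteger
    (begin
      fromℕ c * (↥ (α i) / 1)            ≡⟨ cong (fromℕ c *_) (↧ₙ*p≡↥p (α i)) ⟨
      fromℕ c * (fromℕ (n α i) * α i)    ≡⟨ ℚ.*-assoc (fromℕ c) (fromℕ (n α i)) (α i) ⟨
      fromℕ c * fromℕ (n α i) * α i      ≡⟨ cong (_* α i) (fromℕ-* c (n α i)) ⟨
      fromℕ (c ℕ.* n α i) * α i          ∎)
    (*-isInteger (fromℕ c) (↥ (α i) / 1) (/1-isInteger (+ c)) (/1-isInteger (↥ (α i))))
    where open ≡-Reasoning

  weight*α-isInteger : ∀ {i j} → i ≢ j → IsInteger (fromℕ (weight i) * α j)
  weight*α-isInteger {i} {j} i≢j = n∣⇒*α-isInteger j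
    (ℕ.m*n∣o⇒n∣o/m (n α i) (n α j) (*∣∏ℕ (n α) i≢j))

  a/n-nonNeg : ∀ c i → 0ℚ ≤ a/n α c i
  a/n-nonNeg c i = /-nonNeg (lookup c i) (n α i)

  n*a/n : ∀ c i → fromℕ (n α i) * a/n α c i ≡ fromℕ (lookup c i)
  n*a/n c i = begin
    fromℕ d * (+ x / d)          ≡⟨ cong (fromℕ d *_) (/≡*1/ x d) ⟩
    fromℕ d * (fromℕ x * ν)      ≡⟨ solve 3 (λ d x ν → d :* (x :* ν) := x :* (d :* ν)) refl (fromℕ d) (fromℕ x) ν ⟩
    fromℕ x * (fromℕ d * ν)      ≡⟨ cong (fromℕ x *_) (d*1/d≡1 d) ⟩
    fromℕ x * 1ℚ                 ≡⟨ ℚ.*-identityʳ (fromℕ x) ⟩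
    fromℕ x                      ∎
    where
    open ≡-Reasoning
    open +-*-Solver
    d = n α i
    x = lookup c i
    ν = + 1 / d

  -- Replacing the punctured sums by full ones cancels the `j`-th cross terms. As the first product
  -- is `A b αⱼ`, the form is seen to be `A` times the `j`-th entry of the tuple with slacks `c`.
  form-expand : ∀ c j → form α c j ≡ fromℕ (N α) * ∑ (a/n α c) * α j - Aℚ α * a/n α c j
  form-expand c j = trans
    (cong₂ (λ s t → M * (1ℚ - s) * u j + M * α j * t)
      (∑-except-correct j α) (∑-except-correct j u))
    (solve 5 (λ M S U x y →
        M :* (con 1ℚ :- (S :- x)) :* y :+ M :* x :* (U :- y)
        := M :* U :* x :- M :* (S :- con 1ℚ) :* y)
      refl M (∑ α) (∑ u) (α j) (u j))
    where
    open +-*-Solver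
    M = fromℕ (N α)
    u = a/n α c

  -- The graph of the bijection, given by equations over ℚ. It contains no absolute value or
  -- division with remainder, so the consequences for `b`, `𝒜` and admissibility are plain algebra
  -- for both directions.
  record Slack (g : ℕ) (v c : Vec ℕ k) : Set where
    constructor _,_
    field
      sum≡  : Vec.sum v ≡ g
      entry : ∀ i → fromℕ (lookup v i) + a/n α c i ≡ α i * fromℕ g
  open Slack

  -- asℕ takes absolute values, so this is meaningful only for admissible v.
  slack : ℕ → Vec ℕ k → Vec ℕ k
  slack g v = tabulate λ i → asℕ (fromℕ (n α i) * (α i * fromℕ g - fromℕ (lookup v i)))

  -- `asℕ` loses nothing here: admissibility is the nonnegativity of `αᵢ g − vᵢ`, and multiplying by
  -- `nᵢ` clears its denominator because `nᵢ αᵢ` is an integer.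
  slack-correct : ∀ {g v} → Admissible α g v → Slack g v (slack g v)
  slack-correct {g} {v} (sum≡g , v≤αg) = sum≡g , λ i → *-cancelˡ-≡ (fromℕ (n α i))
    {{ℚ.pos⇒nonZero (fromℕ (n α i)) {{ℚ.normalize-pos (n α i) 1}}}} (entry′ i)
    where
    open ≡-Reasoning
    open +-*-Solver
    entry′ : ∀ i → fromℕ (n α i) * (fromℕ (lookup v i) + a/n α (slack g v) i) ≡ fromℕ (n α i) * (α i * fromℕ g)
    entry′ i = begin
      d * (x + a/n α (slack g v) i)
        ≡⟨ ℚ.*-distribˡ-+ d x (a/n α (slack g v) i) ⟩
      d * x + d * a/n α (slack g v) i
        ≡⟨ cong (_+_ (d * x)) (n*a/n (slack g v) i) ⟩
      d * x + fromℕ (lookup (slack g v) i)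
        ≡⟨ cong (λ m → d * x + fromℕ m) (Vec.lookup∘tabulate _ i) ⟩
      d * x + fromℕ (asℕ (d * y))
        ≡⟨ cong (_+_ (d * x)) (asℕ-correct (*-nonNeg (/-nonNeg (n α i) 1) y-nonNeg) y-isInteger) ⟩
      d * x + d * (α i * fromℕ g - x)
        ≡⟨ solve 3 (λ d x z → d :* x :+ d :* (z :- x) := d :* z) refl d x (α i * fromℕ g) ⟩
      d * (α i * fromℕ g) ∎
      where
      d = fromℕ (n α i)
      x = fromℕ (lookup v i)
      y = α i * fromℕ g - x
      y-nonNeg : 0ℚ ≤ y
      y-nonNeg = subst (_≤ y) (ℚ.+-inverseʳ x) (ℚ.+-monoˡ-≤ (- x) (v≤αg i))
      y-isInteger : IsInteger (d * y)
      y-isInteger = subst IsInteger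
        (solve 4 (λ d a g x → d :* a :* g :+ d :* (:- x) := d :* (a :* g :- x)) refl d (α i) (fromℕ g) x)
        (+-isInteger (d * α i * fromℕ g) (d * - x)
          (*-isInteger (d * α i) (fromℕ g) (n∣⇒*α-isInteger i ℕ.∣-refl) (/1-isInteger (+ g)))
          (*-isInteger d (- x) (/1-isInteger (+ n α i)) (neg-isInteger x (/1-isInteger (+ lookup v i)))))

  Slack⇒Admissible : ∀ {g v c} → Slack g v c → Admissible α g v
  Slack⇒Admissible {g} {v} {c} s = sum≡ s , λ i →
    subst₂ _≤_ (ℚ.+-identityʳ (fromℕ (lookup v i))) (entry s i)
      (ℚ.+-monoʳ-≤ (fromℕ (lookup v i)) (a/n-nonNeg c i))

  Slack-functional : ∀ {g v c c′} → Slack g v c → Slack g v c′ → c ≡ c′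
  Slack-functional {g} {v} {c} {c′} s s′ = lookup-ext λ i → fromℕ-injective (begin
    fromℕ (lookup c i)              ≡⟨ n*a/n c i ⟨
    fromℕ (n α i) * a/n α c i       ≡⟨ cong (fromℕ (n α i) *_) (∙-cancelˡ (fromℕ (lookup v i)) _ _ (trans (entry s i) (sym (entry s′ i)))) ⟩
    fromℕ (n α i) * a/n α c′ i      ≡⟨ n*a/n c′ i ⟩
    fromℕ (lookup c′ i)             ∎)
    where
    open ≡-Reasoning
    open GroupProperties ℚ.+-0-group using (∙-cancelˡ)

  Slack-injective : ∀ {g v v′ c} → Slack g v c → Slack g v′ c → v ≡ v′
  Slack-injective {c = c} s s′ = lookup-ext λ i → fromℕ-injective
    (∙-cancelʳ (a/n α c i) _ _ (trans (entry s i) (sym (entry s′ i))))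
    where open GroupProperties ℚ.+-0-group using (∙-cancelʳ)

  Slack⇒∑ : ∀ {g v c} → Slack g v c → fromℕ (N α) * ∑ (a/n α c) ≡ Aℚ α * fromℕ g
  Slack⇒∑ {g} {v} {c} s = begin
    M * U                         ≡⟨ solve 3 (λ M U x → M :* U := M :* (x :+ U :- x)) refl M U (fromℕ g) ⟩
    M * (fromℕ g + U - fromℕ g)   ≡⟨ cong (λ t → M * (t - fromℕ g)) total ⟩
    M * (∑ α * fromℕ g - fromℕ g) ≡⟨ solve 3 (λ M S x → M :* (S :* x :- x) := M :* (S :- con 1ℚ) :* x) refl M (∑ α) (fromℕ g) ⟩
    Aℚ α * fromℕ g                ∎
    where
    open ≡-Reasoning
    open +-*-Solver
    M = fromℕ (N α)
    U = ∑ (a/n α c)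
    total : fromℕ g + U ≡ ∑ α * fromℕ g
    total = begin
      fromℕ g + U
        ≡⟨ cong (λ x → fromℕ x + U) (sum≡ s) ⟨
      fromℕ (Vec.sum v) + U
        ≡⟨ cong (_+ U) (∑-fromℕ v) ⟨
      ∑ (fromℕ ∘ lookup v) + U
        ≡⟨ ∑ℚ.∑-distrib-+ (fromℕ ∘ lookup v) (a/n α c) ⟨
      ∑ (λ i → fromℕ (lookup v i) + a/n α c i)
        ≡⟨ ∑ℚ.sum-cong-≗ (entry s) ⟩
      ∑ (λ i → α i * fromℕ g)
        ≡⟨ ∑ℚ.*-distribʳ-sum (fromℕ g) α ⟨
      ∑ α * fromℕ g ∎

  module _ (1<∑α : 1ℚ < ∑ α) where

    private
      instance
        Aℚ≢0 : NonZero (Aℚ α)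
        Aℚ≢0 = Aℚ-nonZero α 1<∑α

    A-nonZero : ℕ.NonZero (A α)
    A-nonZero = ℕ.≢-nonZero λ A≡0 → ℚ.<-irrefl (trans (cong fromℕ (sym A≡0)) (A-correct α 1<∑α))
      (ℚ.positive⁻¹ (Aℚ α) {{Aℚ-positive α 1<∑α}})

    A*bℚ : ∀ c → Aℚ α * bℚ α c ≡ fromℕ (N α) * ∑ (a/n α c)
    A*bℚ c = begin
      Aℚ α * (M * 1/ Aℚ α * U)    ≡⟨ solve 4 (λ a M r U → a :* (M :* r :* U) := a :* r :* (M :* U)) refl (Aℚ α) M (1/ Aℚ α) U ⟩
      Aℚ α * 1/ Aℚ α * (M * U)    ≡⟨ cong (_* (M * U)) (ℚ.*-inverseʳ (Aℚ α)) ⟩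
      1ℚ * (M * U)                ≡⟨ ℚ.*-identityˡ (M * U) ⟩
      M * U                       ∎
      where
      open ≡-Reasoning
      open +-*-Solver
      M = fromℕ (N α)
      U = ∑ (a/n α c)

    Slack⇒b : ∀ {g v c} → Slack g v c → b α c ≡ g
    Slack⇒b {g} {v} {c} s = trans (cong asℕ bℚ≡g) (asℕ-fromℕ g)
      where
      bℚ≡g : bℚ α c ≡ fromℕ g
      bℚ≡g = *-cancelˡ-≡ (Aℚ α) (trans (A*bℚ c) (Slack⇒∑ s))

    Slack⇒𝒜 : ∀ {g v c} → Slack g v c → 𝒜-condition α c
    Slack⇒𝒜 {g} {v} {c} s j = subst (A α divides_) (sym form≡) (multiple⇒divides (A α) (+ lookup v j))
      where
      open ≡-Reasoning
      open +-*-Solver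
      x = fromℕ (lookup v j)
      y = a/n α c j
      form≡ : form α c j ≡ fromℕ (A α) * x
      form≡ = begin
        form α c j
          ≡⟨ form-expand c j ⟩
        fromℕ (N α) * ∑ (a/n α c) * α j - Aℚ α * y
          ≡⟨ cong (λ t → t * α j - Aℚ α * y) (Slack⇒∑ s) ⟩
        Aℚ α * fromℕ g * α j - Aℚ α * y
          ≡⟨ solve 4 (λ a g x y → a :* g :* x :- a :* y := a :* (x :* g) :- a :* y) refl (Aℚ α) (fromℕ g) (α j) y ⟩
        Aℚ α * (α j * fromℕ g) - Aℚ α * y
          ≡⟨ cong (λ t → Aℚ α * t - Aℚ α * y) (entry s j) ⟨
        Aℚ α * (x + y) - Aℚ α * y
          ≡⟨ solve 3 (λ a x y → a :* (x :+ y) :- a :* y := a :* x) refl (Aℚ α) x y ⟩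
        Aℚ α * x
          ≡⟨ cong (_* x) (A-correct α 1<∑α) ⟨
        fromℕ (A α) * x ∎

    -- The single term `N cᵢ/nᵢ` is at most the whole sum of nonnegative terms, which is `A g`. This
    -- is where the side `q A` of the box comes from.
    Slack-bound : ∀ {g v c} q → Slack g v c → g ℕ.< q → ∀ i → lookup c i ℕ.< q ℕ.* A α
    Slack-bound {g} {v} {c} q s g<q i = begin-strict
      lookup c i                    ≤⟨ ℕ.m≤n*m (lookup c i) (weight i) {{weight-nonZero i}} ⟩
      weight i ℕ.* lookup c i       ≤⟨ fromℕ-cancel-≤ scaled ⟩
      g ℕ.* A α                     <⟨ ℕ.*-monoˡ-< (A α) {{A-nonZero}} g<q ⟩
      q ℕ.* A α                     ∎
      where
      open ℕ.≤-Reasoning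
      open +-*-Solver
      M = fromℕ (N α)
      scaled : fromℕ (weight i ℕ.* lookup c i) ≤ fromℕ (g ℕ.* A α)
      scaled = subst₂ _≤_
        (sym (trans (fromℕ-* (weight i) (lookup c i)) (trans
          (cong (_* fromℕ (lookup c i)) (fromℕ-weight i)) (trans
          (solve 3 (λ m ν x → m :* ν :* x := m :* (x :* ν)) refl M (+ 1 / n α i) (fromℕ (lookup c i)))
          (cong (M *_) (sym (/≡*1/ (lookup c i) (n α i))))))))
        (trans (Slack⇒∑ s) (trans (ℚ.*-comm (Aℚ α) (fromℕ g)) (sym (trans (fromℕ-* g (A α))
          (cong (fromℕ g *_) (A-correct α 1<∑α))))))
        (ℚ.*-monoˡ-≤-nonNeg M {{nonNegative (/-nonNeg (N α) 1)}}
          (≤-∑ (a/n α c) (a/n-nonNeg c) i))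

    -- Failure of the condition becomes a zero summand instead of a deleted list entry, so sums run
    -- over full boxes and split coordinate by coordinate.
    monomial : Vec ℕ k → PowerSeries
    monomial c = if does (𝒜-condition? α c) then x^ b α c else 0ₚ

    module _ (0≤α : ∀ i → 0ℚ ≤ α i) (∑-except≤1 : ∀ i → ∑-except i α ≤ 1ℚ) where

      -- The bound on punctured sums says that `α̂ⱼ` is nonnegative, so both products in the form
      -- are. This rules out negative entries in the reconstructed tuple.
      form-nonNeg : ∀ c j → 0ℚ ≤ form α c j
      form-nonNeg c j = ℚ.+-mono-≤
        (*-nonNeg (*-nonNeg 0≤N (subst (_≤ α̂ α j) (ℚ.+-inverseʳ (∑-except j α))
          (ℚ.+-monoˡ-≤ (- ∑-except j α) (∑-except≤1 j)))) (a/n-nonNeg c j))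
        (*-nonNeg (*-nonNeg 0≤N (0≤α j)) (∑-except-nonNeg j (a/n α c) (a/n-nonNeg c)))
        where 0≤N = /-nonNeg (N α) 1

      -- Entry `j` is the form divided by `A`. The divisibility witness speaks of the absolute value
      -- of the numerator, which is harmless by `form-nonNeg`.
      unslack : ∀ c → 𝒜-condition α c → Vec ℕ k
      unslack c c∈𝒜 = tabulate λ j → ℕ.quotient (proj₂ (c∈𝒜 j))

      -- After multiplication by `A` both requirements are identities about the forms: they total
      -- `A b`, and `form-expand` writes each as `A (αⱼ b − cⱼ/nⱼ)`.
      unslack-correct : ∀ c (c∈𝒜 : 𝒜-condition α c) → Slack (b α c) (unslack c c∈𝒜) c
      unslack-correct c c∈𝒜 = fromℕ-injective (*-cancelˡ-≡ (Aℚ α) A*sum) ,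
        λ j → *-cancelˡ-≡ (Aℚ α) (A*entry j)
        where
        open ≡-Reasoning
        open +-*-Solver
        v = unslack c c∈𝒜
        A*v : ∀ j → Aℚ α * fromℕ (lookup v j) ≡ form α c j
        A*v j = begin
          Aℚ α * fromℕ (lookup v j)              ≡⟨ cong₂ (λ a x → a * fromℕ x) (sym (A-correct α 1<∑α)) (Vec.lookup∘tabulate _ j) ⟩
          fromℕ (A α) * fromℕ (ℕ.quotient A∣)    ≡⟨ ℚ.*-comm (fromℕ (A α)) (fromℕ (ℕ.quotient A∣)) ⟩
          fromℕ (ℕ.quotient A∣) * fromℕ (A α)    ≡⟨ fromℕ-* (ℕ.quotient A∣) (A α) ⟨
          fromℕ (ℕ.quotient A∣ ℕ.* A α)          ≡⟨ cong fromℕ (ℕ._∣_.equality A∣) ⟨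
          fromℕ (asℕ (form α c j))               ≡⟨ asℕ-correct (form-nonNeg c j) (proj₁ (c∈𝒜 j)) ⟩
          form α c j ∎
          where A∣ = proj₂ (c∈𝒜 j)
        MU≡ : fromℕ (N α) * ∑ (a/n α c) ≡ Aℚ α * fromℕ (b α c)
        MU≡ = trans (sym (A*bℚ c)) (cong (Aℚ α *_) (sym (b-correct α 1<∑α c c∈𝒜)))
        A*sum : Aℚ α * fromℕ (Vec.sum v) ≡ Aℚ α * fromℕ (b α c)
        A*sum = begin
          Aℚ α * fromℕ (Vec.sum v)                  ≡⟨ cong (Aℚ α *_) (∑-fromℕ v) ⟨
          Aℚ α * ∑ (fromℕ ∘ lookup v)               ≡⟨ ∑ℚ.*-distribˡ-sum (Aℚ α) (fromℕ ∘ lookup v) ⟩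
          ∑ (λ j → Aℚ α * fromℕ (lookup v j))       ≡⟨ ∑ℚ.sum-cong-≗ A*v ⟩
          ∑ (form α c)                              ≡⟨ ∑-form α c ⟩
          fromℕ (N α) * ∑ (a/n α c)                 ≡⟨ MU≡ ⟩
          Aℚ α * fromℕ (b α c)                      ∎
        A*entry : ∀ j → Aℚ α * (fromℕ (lookup v j) + a/n α c j) ≡ Aℚ α * (α j * fromℕ (b α c))
        A*entry j = begin
          Aℚ α * (fromℕ (lookup v j) + y)
            ≡⟨ ℚ.*-distribˡ-+ (Aℚ α) (fromℕ (lookup v j)) y ⟩
          Aℚ α * fromℕ (lookup v j) + Aℚ α * y
            ≡⟨ cong (_+ Aℚ α * y) (trans (A*v j) (form-expand c j)) ⟩
          fromℕ (N α) * ∑ (a/n α c) * α j - Aℚ α * y + Aℚ α * y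
            ≡⟨ cong (λ t → t * α j - Aℚ α * y + Aℚ α * y) MU≡ ⟩
          Aℚ α * fromℕ (b α c) * α j - Aℚ α * y + Aℚ α * y
            ≡⟨ solve 4 (λ a g x y → a :* g :* x :- a :* y :+ a :* y := a :* (x :* g)) refl (Aℚ α) (fromℕ (b α c)) (α j) y ⟩
          Aℚ α * (α j * fromℕ (b α c)) ∎
          where y = a/n α c j

      box≡F : ∀ {g q} → g ℕ.< q → box k (q ℕ.* A α) monomial g ≡ F α g
      box≡F {g} {q} g<q = trans
        (∑ₚ-length lattice? monomial g (λ c → if-×-dec (𝒜-condition? α c) (b α c) g) (tuples k B))
        (cong +_ (sym (bijection⇒length≡ (slack g)
          (Unique.filter⁺ (admissible? α g) (tuples-unique k (suc g)))
          (Unique.filter⁺ lattice? (tuples-unique k B))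
          (λ v∈ v′∈ eq → Slack-injective (∈⇒Slack v∈) (subst (Slack g _) (sym eq) (∈⇒Slack v′∈)))
          into onto)))
        where
        B = q ℕ.* A α
        Lattice : Vec ℕ k → Set
        Lattice c = 𝒜-condition α c × g ≡ b α c
        lattice? : ∀ c → Dec (Lattice c)
        lattice? c = 𝒜-condition? α c ×-dec (g ℕ.≟ b α c)
        ∈⇒Slack : ∀ {v} → v ∈ filter (admissible? α g) (tuples k (suc g)) → Slack g v (slack g v)
        ∈⇒Slack v∈ = slack-correct (proj₂ (∈.∈-filter⁻ (admissible? α g) {xs = tuples k (suc g)} v∈))
        into : ∀ {v} → v ∈ filter (admissible? α g) (tuples k (suc g)) → slack g v ∈ filter lattice? (tuples k B)
        into {v} v∈ = ∈.∈-filter⁺ lattice?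
          -- Only here does the size of the box matter: with `g < q` no slack tuple of total `g`
          -- falls outside it.
          (∈-tuples⁺ (slack g v) (Slack-bound q s g<q)) (Slack⇒𝒜 s , sym (Slack⇒b s))
          where s = ∈⇒Slack v∈
        onto : ∀ {c} → c ∈ filter lattice? (tuples k B) →
               ∃[ v ] v ∈ filter (admissible? α g) (tuples k (suc g)) × c ≡ slack g v
        onto {c} c∈ =
          v , ∈.∈-filter⁺ (admissible? α g) (∈-tuples⁺ v v<) adm , Slack-functional s (slack-correct adm)
          where
          c-lattice : Lattice c
          c-lattice = proj₂ (∈.∈-filter⁻ lattice? {xs = tuples k B} c∈)
          c∈𝒜 = proj₁ c-lattice
          v = unslack c c∈𝒜
          s : Slack g v c
          s = subst (λ g → Slack g v c) (sym (proj₂ c-lattice)) (unslack-correct c c∈𝒜)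
          adm = Slack⇒Admissible s
          v< : ∀ i → lookup v i ℕ.< suc g
          v< i = s≤s (subst (lookup v i ℕ.≤_) (sum≡ s) (lookup-≤-sum v i))

    -- Adding A eᵢ to c raises form α c j by A times this integer.
    step : Fin k → Fin k → ℚ
    step i j = fromℕ (weight i) * α j - single i (fromℕ (weight i) * (∑ α - 1ℚ)) j

    -- Write `wᵢ = N/nᵢ`. Off the diagonal `wᵢ αⱼ` is an integer. On it `wᵢ αᵢ` need not be one, but
    -- `wᵢ αᵢ − wᵢ (∑ α − 1)` equals `wᵢ` minus the sum of the off-diagonal `wᵢ αⱼ`.
    step-isInteger : ∀ i j → IsInteger (step i j)
    step-isInteger i j = lemma (i Fin.≟ j)
      where
      open ≡-Reasoning
      open +-*-Solver
      w = fromℕ (weight i)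
      wα : Vector ℚ k
      wα j = w * α j
      diagonal : w - ∑-except i wα ≡ w * α i - w * (∑ α - 1ℚ)
      diagonal = begin
        w - ∑-except i wα          ≡⟨ cong (_-_ w) (∑-except-correct i wα) ⟩
        w - (∑ wα - w * α i)       ≡⟨ cong (λ t → w - (t - w * α i)) (∑ℚ.*-distribˡ-sum w α) ⟨
        w - (w * ∑ α - w * α i)    ≡⟨ solve 3 (λ w S x → w :- (w :* S :- w :* x) := w :* x :- w :* (S :- con 1ℚ)) refl w (∑ α) (α i) ⟩
        w * α i - w * (∑ α - 1ℚ)   ∎
      lemma : Dec (i ≡ j) → IsInteger (step i j)
      lemma (no i≢j)   = subst IsInteger
        (trans (sym (ℚ.+-identityʳ (w * α j))) (cong (_-_ (w * α j)) (sym (single-≢ _ i≢j))))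
        (weight*α-isInteger i≢j)
      lemma (yes refl) = subst IsInteger
        (trans diagonal (cong (_-_ (w * α i)) (sym (single-≡ i _))))
        (+-isInteger w (- ∑-except i wα) (/1-isInteger (+ weight i))
          (neg-isInteger (∑-except i wα) (∑-except-isInteger i wα (λ j → weight*α-isInteger))))

    -- The effect of adding `A` to one coordinate

    module _ (c : Vec ℕ k) (i : Fin k) where

      private
        c⁺ = updateAt c i (A α ℕ.+_)
        w = fromℕ (weight i)
        M = fromℕ (N α)
        ν = + 1 / n α i

      a/n-updateAt : ∀ j → a/n α c⁺ j ≡ a/n α c j + single i (Aℚ α * ν) j
      a/n-updateAt j = lemma (i Fin.≟ j)
        where
        open ≡-Reasoning
        open +-*-Solver
        x = lookup c i
        lemma : Dec (i ≡ j) → a/n α c⁺ j ≡ a/n α c j + single i (Aℚ α * ν) j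
        lemma (no i≢j)   = begin
          a/n α c⁺ j                               ≡⟨ cong (λ x → + x / n α j) (Vec.lookup∘updateAt′ j i (i≢j ∘ sym) c) ⟩
          a/n α c j                                ≡⟨ ℚ.+-identityʳ (a/n α c j) ⟨
          a/n α c j + 0ℚ                           ≡⟨ cong (_+_ (a/n α c j)) (single-≢ (Aℚ α * ν) i≢j) ⟨
          a/n α c j + single i (Aℚ α * ν) j        ∎
        lemma (yes refl) = begin
          a/n α c⁺ i                              ≡⟨ cong (λ x → + x / n α i) (Vec.lookup∘updateAt i c) ⟩
          + (A α ℕ.+ x) / n α i                   ≡⟨ /≡*1/ (A α ℕ.+ x) (n α i) ⟩
          fromℕ (A α ℕ.+ x) * ν                   ≡⟨ cong (_* ν) (fromℕ-+ (A α) x) ⟩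
          (fromℕ (A α) + fromℕ x) * ν             ≡⟨ cong (λ a → (a + fromℕ x) * ν) (A-correct α 1<∑α) ⟩
          (Aℚ α + fromℕ x) * ν                    ≡⟨ solve 3 (λ a x ν → (a :+ x) :* ν := x :* ν :+ a :* ν) refl (Aℚ α) (fromℕ x) ν ⟩
          fromℕ x * ν + Aℚ α * ν                  ≡⟨ cong (_+ Aℚ α * ν) (/≡*1/ x (n α i)) ⟨
          a/n α c i + Aℚ α * ν                    ≡⟨ cong (_+_ (a/n α c i)) (single-≡ i (Aℚ α * ν)) ⟨
          a/n α c i + single i (Aℚ α * ν) i       ∎

      N*∑-updateAt : M * ∑ (a/n α c⁺) ≡ M * ∑ (a/n α c) + Aℚ α * w
      N*∑-updateAt = begin
        M * ∑ (a/n α c⁺)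
          ≡⟨ cong (M *_) (∑ℚ.sum-cong-≗ a/n-updateAt) ⟩
        M * ∑ (λ j → a/n α c j + single i (Aℚ α * ν) j)
          ≡⟨ cong (M *_) (∑ℚ.∑-distrib-+ (a/n α c) (single i (Aℚ α * ν))) ⟩
        M * (∑ (a/n α c) + ∑ (single i (Aℚ α * ν)))
          ≡⟨ cong (λ t → M * (∑ (a/n α c) + t)) (∑-single i (Aℚ α * ν)) ⟩
        M * (∑ (a/n α c) + Aℚ α * ν)
          ≡⟨ solve 4 (λ M U a ν → M :* (U :+ a :* ν) := M :* U :+ a :* (M :* ν)) refl M (∑ (a/n α c)) (Aℚ α) ν ⟩
        M * ∑ (a/n α c) + Aℚ α * (M * ν)
          ≡⟨ cong (λ t → M * ∑ (a/n α c) + Aℚ α * t) (fromℕ-weight i) ⟨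
        M * ∑ (a/n α c) + Aℚ α * w ∎
        where
        open ≡-Reasoning
        open +-*-Solver

      -- Since `A = N (∑ α − 1)`, the increment `A/nᵢ` is `(N/nᵢ) (∑ α − 1)`; in this shape it can
      -- be combined with `(N/nᵢ) αⱼ` into `step`.
      A*single : ∀ j → Aℚ α * single i (Aℚ α * ν) j ≡ Aℚ α * single i (w * (∑ α - 1ℚ)) j
      A*single j = cong (λ x → Aℚ α * single i x j) (begin
        M * (∑ α - 1ℚ) * ν   ≡⟨ solve 3 (λ M s ν → M :* s :* ν := M :* ν :* s) refl M (∑ α - 1ℚ) ν ⟩
        M * ν * (∑ α - 1ℚ)   ≡⟨ cong (_* (∑ α - 1ℚ)) (fromℕ-weight i) ⟨
        w * (∑ α - 1ℚ)       ∎)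
        where
        open ≡-Reasoning
        open +-*-Solver

      form-updateAt : ∀ j → form α c⁺ j ≡ form α c j + fromℕ (A α) * step i j
      form-updateAt j = begin
        form α c⁺ j
          ≡⟨ form-expand c⁺ j ⟩
        M * ∑ (a/n α c⁺) * α j - Aℚ α * a/n α c⁺ j
          ≡⟨ cong₂ (λ s t → s * α j - Aℚ α * t) N*∑-updateAt (a/n-updateAt j) ⟩
        (MU + Aℚ α * w) * α j - Aℚ α * (a/n α c j + single i (Aℚ α * ν) j)
          ≡⟨ solve 6 (λ u a w x y z → (u :+ a :* w) :* x :- a :* (y :+ z)
               := u :* x :- a :* y :+ (a :* (w :* x) :- a :* z)) refl MU (Aℚ α) w (α j) (a/n α c j) (single i (Aℚ α * ν) j) ⟩
        MU * α j - Aℚ α * a/n α c j + (Aℚ α * (w * α j) - Aℚ α * single i (Aℚ α * ν) j)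
          ≡⟨ cong₂ (λ s t → s + (Aℚ α * (w * α j) - t)) (sym (form-expand c j)) (A*single j) ⟩
        form α c j + (Aℚ α * (w * α j) - Aℚ α * z)
          ≡⟨ cong (_+_ (form α c j)) (solve 3 (λ a x z → a :* x :- a :* z := a :* (x :- z)) refl (Aℚ α) (w * α j) z) ⟩
        form α c j + Aℚ α * step i j
          ≡⟨ cong (λ a → form α c j + a * step i j) (A-correct α 1<∑α) ⟨
        form α c j + fromℕ (A α) * step i j ∎
        where
        open ≡-Reasoning
        open +-*-Solver
        MU = M * ∑ (a/n α c)
        z = single i (w * (∑ α - 1ℚ)) j

      𝒜-updateAt⁺ : 𝒜-condition α c → 𝒜-condition α c⁺
      𝒜-updateAt⁺ c∈𝒜 j = subst (A α divides_) (sym (form-updateAt j))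
        (divides-+ (form α c j) (step i j) (step-isInteger i j) (c∈𝒜 j))

      𝒜-updateAt⁻ : 𝒜-condition α c⁺ → 𝒜-condition α c
      𝒜-updateAt⁻ c⁺∈𝒜 j = subst (A α divides_) eq
        (divides-+ (form α c⁺ j) (- step i j) (neg-isInteger (step i j) (step-isInteger i j)) (c⁺∈𝒜 j))
        where
        open +-*-Solver
        eq : form α c⁺ j + fromℕ (A α) * - step i j ≡ form α c j
        eq = trans (cong (_+ fromℕ (A α) * - step i j) (form-updateAt j))
          (solve 3 (λ f a t → f :+ a :* t :+ a :* (:- t) := f) refl (form α c j) (fromℕ (A α)) (step i j))

      b-updateAt : 𝒜-condition α c → b α c⁺ ≡ weight i ℕ.+ b α c
      b-updateAt c∈𝒜 = fromℕ-injective (*-cancelˡ-≡ (Aℚ α) (begin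
        Aℚ α * fromℕ (b α c⁺)                 ≡⟨ cong (Aℚ α *_) (b-correct α 1<∑α c⁺ (𝒜-updateAt⁺ c∈𝒜)) ⟩
        Aℚ α * bℚ α c⁺                        ≡⟨ A*bℚ c⁺ ⟩
        M * ∑ (a/n α c⁺)                      ≡⟨ N*∑-updateAt ⟩
        M * ∑ (a/n α c) + Aℚ α * w            ≡⟨ cong (_+ Aℚ α * w) (A*bℚ c) ⟨
        Aℚ α * bℚ α c + Aℚ α * w              ≡⟨ cong (λ t → Aℚ α * t + Aℚ α * w) (b-correct α 1<∑α c c∈𝒜) ⟨
        Aℚ α * fromℕ (b α c) + Aℚ α * w       ≡⟨ solve 3 (λ a x w → a :* x :+ a :* w := a :* (w :+ x)) refl (Aℚ α) (fromℕ (b α c)) w ⟩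
        Aℚ α * (w + fromℕ (b α c))            ≡⟨ cong (Aℚ α *_) (fromℕ-+ (weight i) (b α c)) ⟨
        Aℚ α * fromℕ (weight i ℕ.+ b α c)     ∎))
        where
        open ≡-Reasoning
        open +-*-Solver

      monomial-periodic : monomial c⁺ ≈ shift (weight i) (monomial c)
      monomial-periodic = if-periodic (𝒜-condition? α c) (𝒜-condition? α c⁺)
        𝒜-updateAt⁺ 𝒜-updateAt⁻ (weight i) b-updateAt

mainTheorem8 : ∀ (k : ℕ) → 2 ℕ.≤ k →
    (α : Fin k → ℚ) →
    (∀ i → 0ℚ ≤ α i) →
    (∀ i → ∑-except i α ≤ 1ℚ) →
    (1<∑α : 1ℚ < ∑ α) →
    F α ≈ numerator α {{Aℚ-nonZero α 1<∑α}} ⊘ denominator α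
mainTheorem8 k _ α 0≤α ∑-except≤1 1<∑α = denominator-unit , λ n → begin
  (F α ⊛ denominator α) n
    -- A single box with `suc n` periods per side serves all coefficients of `F` up to `n`, and the
    -- same number of periods makes the telescoping exact in degree `n`.
    ≡⟨ ⊛-cong-≤ n {q = denominator α} (λ m m≤n → sym (box≡F α 1<∑α 0≤α ∑-except≤1 (s≤s m≤n))) (λ _ → refl) ⟩
  (box k (suc n ℕ.* A α) (monomial α 1<∑α) ⊛ denominator α) n
    ≡⟨ box-⊛ (A α) (suc n) (weight α) (weight-nonZero α) (monomial α 1<∑α) (monomial-periodic α 1<∑α) n ℕ.≤-refl ⟩
  box k (A α) (monomial α 1<∑α) n
    ≡⟨ ∑ₚ-filter (𝒜-condition? α) (λ a → x^ b α {{Aℚ-nonZero α 1<∑α}} a) (tuples k (A α)) n ⟨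
  numerator α {{Aℚ-nonZero α 1<∑α}} n ∎
  where
  open ≡-Reasoning
  denominator-unit : Unit (denominator α)
  denominator-unit = ∏-unit (λ i → 1-x^ weight α i) λ i →
    geometric (weight α i) , 1-x^-⊛-geometric (weight α i) {{weight-nonZero α i}}
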